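{- For every integer $\delta \geq 1$ there exists an integer $M$ such that for all integers $e,m$ with $3 \leq e < m$, $m-e=\delta$ and $m \geq M$, we have $\mathscr{R}(e,m) = \mathscr{C}(e,m)$. (In words: for each fixed value of $m-e$, $\mathscr{R}(e,m)=\mathscr{C}(e,m)$ for all $m \gg 0$.)
   Context: A numerical monoid is an additive submonoid $\Gamma\subseteq\mathbb{N}$ (containing $0$) with $\mathbb{N}\setminus\Gamma$ finite. It has a unique minimal set of generators $g_0<g_1<\cdots<g_e$; its embedding dimension is $\mathrm{edim}(\Gamma)=e+1$ and its multiplicity is $\mathrm{mult}(\Gamma)=g_0$. Let $\varphi:\mathbb{N}^{e+1}\to\mathbb{N}$, $\varphi(a_0,\dots,a_e)=\sum_i a_ig_i$, and let $\ker\varphi=\{(\mathbf a,\mathbf b)\in\mathbb{N}^{e+1}\times\mathbb{N}^{e+1}: \varphi(\mathbf a)=\varphi(\mathbf b)\}$ (a congruence on $\mathbb{N}^{e+1}$). The number of minimal relations $\rho(\Gamma)$ is the cardinality of a minimal generating set of the congruence $\ker\varphi$ (this is independent of the choice). Define $\mathscr{R}(e,m)=\max\{\rho(\Gamma): \mathrm{edim}(\Gamma)=e+1,\ \mathrm{mult}(\Gamma)=m\}$. For positive integers $n,d$ write the Macaulay expansion $n=\binom{n_d}{d}+\binom{n_{d-1}}{d-1}+\cdots+\binom{n_j}{j}$ with uniquely determined integers $n_d>n_{d-1}>\cdots>n_j\geq j\geq 1$, and set $n^{\langle d\rangle}=\binom{n_d+1}{d+1}+\binom{n_{d-1}+1}{d}+\cdots+\binom{n_j+1}{j+1}$;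 set $0^{\langle d\rangle}=0$. For integers $1<e<m$, let $r$ be the unique integer with $\binom{e+r-1}{r-1}\leq m<\binom{e+r}{r}$, let $s=m-\binom{e+r-1}{r-1}$, and define $\mathscr{C}(e,m)=\binom{e+r-1}{r}+s^{\langle r\rangle}-s$. -}

module Defs where

open import Data.Nat using (ℕ; zero; suc; _+_; _*_; _∸_; _≤_; _<_; _≤?_)
open import Data.Nat.Combinatorics using (_C_)
open import Data.Fin using (Fin; _≟_) renaming (_<_ to _<ᶠ_; zero to fzero)
open import Data.Vec using (Vec; lookup; zipWith; sum)
open import Data.List using (List; length)
open import Data.List.Membership.Propositional using (_∈_)
open import Data.Product using (_×_; _,_; ∃; ∃-syntax)
open import Relation.Nullary using (¬_; yes; no)
open import Relation.Binary.PropositionalEquality using (_≡_)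

φ : ∀ {k} → Vec ℕ k → Vec ℕ k → ℕ
φ g a = sum (zipWith _*_ a g)

InMonoid : ∀ {k} → Vec ℕ k → ℕ → Set
InMonoid {k} g n = ∃[ a ] (φ {k} g a ≡ n)

-- g = (g₀ < g₁ < … < gₑ) is the minimal generating system of a numerical
-- monoid Γ = ⟨g⟩:  strictly increasing; no gᵢ lies in the monoid generated
-- by the other generators (minimality); ℕ ∖ Γ finite.
IsMinGens : (e : ℕ) → Vec ℕ (suc e) → Set
IsMinGens e g =
  (∀ (i j : Fin (suc e)) → i <ᶠ j → lookup g i < lookup g j)
  × (∀ (i : Fin (suc e)) →
       ¬ (∃[ a ] (lookup a i ≡ 0 × φ g a ≡ lookup g i)))
  × (∃[ N ] (∀ n → N ≤ n → InMonoid g n))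

mult : ∀ {e} → Vec ℕ (suc e) → ℕ
mult g = lookup g fzero

_⊕_ : ∀ {k} → Vec ℕ k → Vec ℕ k → Vec ℕ k
a ⊕ b = zipWith _+_ a b

data GenCong {k : ℕ} (R : List (Vec ℕ k × Vec ℕ k)) : Vec ℕ k → Vec ℕ k → Set where
  base  : ∀ {a b} → (a , b) ∈ R → GenCong R a b
  refl′ : ∀ {a} → GenCong R a a
  sym′  : ∀ {a b} → GenCong R a b → GenCong R b a
  trans′ : ∀ {a b c} → GenCong R a b → GenCong R b c → GenCong R a c
  plus  : ∀ {a b c d} → GenCong R a b → GenCong R c d → GenCong R (a ⊕ c) (b ⊕ d)

Generates : ∀ {k} → Vec ℕ k → List (Vec ℕ k × Vec ℕ k) → Set
Generates g R = ∀ a b → (φ g a ≡ φ g b → GenCong R a b) × (GenCong R a b → φ g a ≡ φ g b)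

IsRho : ∀ {k} → Vec ℕ k → ℕ → Set
IsRho g n = (∃[ R ] (length R ≡ n × Generates g R))
          × (∀ R → Generates g R → n ≤ length R)

IsMaxRho : ℕ → ℕ → ℕ → Set
IsMaxRho e m c =
  (∃[ g ] (IsMinGens e g × mult g ≡ m × IsRho g c))
  × (∀ (g : Vec ℕ (suc e)) n → IsMinGens e g → mult g ≡ m → IsRho g n → n ≤ c)

-- largest k ≤ b with (k C d) ≤ n  (0 if none)
maxK : ℕ → ℕ → ℕ → ℕ
maxK n d zero = zero
maxK n d (suc b) with (suc b) C d ≤? n
... | yes _ = suc b
... | no  _ = maxK n d b

-- n^⟨d⟩, computed from the (greedy) Macaulay expansion
--   n = (n_d C d) + (n_{d-1} C d-1) + … ,  n_d maximal with (n_d C d) ≤ n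
macaulayUp : ℕ → ℕ → ℕ
macaulayUp zero d = zero
macaulayUp (suc n) zero = zero
macaulayUp (suc n) (suc d) =
  let k = maxK (suc n) (suc d) (suc n + suc d) in
  (suc k C suc (suc d)) + macaulayUp (suc n ∸ (k C suc d)) d

-- 𝓒(e,m) given r = suc r' with ((e+r-1) C (r-1)) ≤ m < ((e+r) C r)
Cval : ℕ → ℕ → ℕ → ℕ
Cval e m r' =
  let s = m ∸ ((e + r') C r') in
  ((e + r') C suc r') + macaulayUp s (suc r') ∸ s

module Submission where

-- Reduce modulo the multiplicity m: choosing in each residue class the least monomial in the
-- other generators gives an order ideal of at most m irreducible monomials, and the minimal
-- reducible monomials index a generating set of the kernel congruence. Here 1 + e irreducible
-- monomials have degree at most 1, which leaves at most s = δ - 1 of higher degree. Macaulay's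
-- bound for degree 2, valid for order ideals that need not be graded, then limits the number of
-- minimal reducible monomials to (e+1 choose 2) + s^⟨2⟩ - s. Conversely, write
-- s = (A+1 choose 2) + b with b ≤ A; for m large there is a monoid whose irreducible monomials of
-- degree 2 form a lex segment and factor uniquely. Every reducible monomial of degree 2, and
-- every monomial of degree 3 all of whose quadratic divisors lie in the segment, is then an
-- isolated vertex of its fibre, so a generating set needs one relation for each of them.

open import Defs
open import Data.Empty using (⊥; ⊥-elim)
open import Data.Fin using (Fin) renaming (zero to fzero; suc to fsuc; _<_ to _<ᶠ_)
import Data.Fin.Properties as Fin
open import Data.List using (List; []; _∷_; length; map; filter; _++_; upTo)
open import Data.List.Properties using (length-map; length-++; length-upTo)
import Data.List.Membership.DecPropositional as DecMembership
open import Data.List.Membership.Propositional using (_∈_; _∉_; lose; find)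
open import Data.List.Membership.Propositional.Properties
open import Data.List.Relation.Unary.All as All using (All; []; _∷_; all?)
import Data.List.Relation.Unary.All.Properties as All
open import Data.List.Relation.Unary.AllPairs using (AllPairs; []; _∷_)
import Data.List.Relation.Unary.AllPairs.Properties as AllPairs
open import Data.List.Relation.Unary.Any using (here; there; any?)
open import Data.List.Relation.Unary.Unique.Propositional using (Unique)
import Data.List.Relation.Unary.Unique.Propositional.Properties as Unique
open import Data.Nat
open import Data.Nat.Combinatorics using (_C_; nCk+nC[k+1]≡[n+1]C[k+1]; nC1≡n)
open import Data.Nat.DivMod
  using (m≡m%n+[m/n]*n; m%n<n; [m+kn]%n≡m%n; m<n⇒m%n≡m; /-monoˡ-≤; m*n/n≡m)
open import Data.Nat.Induction using () renaming (<-wellFounded to ℕ-wellFounded)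
open import Data.Nat.Properties
open import Data.Nat.Tactic.RingSolver using (solve-∀)
open import Data.Product using (∃-syntax; _×_; _,_; proj₁; proj₂)
open import Data.Sum using (_⊎_; inj₁; inj₂; [_,_]′)
open import Data.Vec
  using (Vec; []; _∷_; head; tail; lookup; replicate; sum; fromList; splitAt)
  renaming (_++_ to _++ᵛ_; map to mapᵛ)
open import Data.Vec.Properties
  using (≡-dec; lookup-replicate; zipWith-comm; zipWith-assoc; zipWith-identityˡ; zipWith-identityʳ;
         sum-++; ++-injectiveˡ)
open import Data.Vec.Relation.Binary.Lex.Strict as Lex using (Lex-<; this; next)
open import Data.Vec.Relation.Binary.Pointwise.Inductive using (Pointwise-≡⇒≡; ≡⇒Pointwise-≡)
import Data.Vec.Relation.Unary.All as AllV
import Data.Vec.Relation.Unary.All.Properties as AllV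
import Data.Vec.Relation.Unary.AllPairs as AllPairsV
import Data.Vec.Relation.Unary.AllPairs.Properties as AllPairsV
open import Function using (_∘_; id)
open import Induction.WellFounded using (WellFounded; Acc; acc)
open import Relation.Binary using (DecidableEquality; tri<; tri≈; tri>)
import Relation.Binary.Construct.On as On
open import Relation.Binary.PropositionalEquality
  using (_≡_; _≢_; refl; sym; trans; cong; cong₂; subst; subst₂; module ≡-Reasoning)
open import Relation.Nullary using (¬_; yes; no; contradiction)
open import Relation.Nullary.Decidable using (map′; _×-dec_; _⊎-dec_; ¬?)
open import Relation.Unary using (Decidable)
open import Relation.Unary.Properties using (∁?)

-- The graded form of Macaulay's bound does not suffice: `s` counts irreducible monomials of all
-- degrees above 1 together, so the minimal reducible monomials of all degrees above 2 must be
-- charged to them at once. The upper bound therefore counts one family in two ways, the monomials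
-- of degree at least 2 whose quotients by a variable are all irreducible: by reducibility, and by
-- degree being 2 or larger. The lower bound never decides which of its `tri e + F s` candidates are
-- reducible; at most `s` of them can be irreducible, because irreducible monomials have distinct
-- residues. That isolated vertices cost one relation each is shown by cuts: if no relation leaves a
-- set of reducible isolated vertices, the congruence cannot join its members to their normal forms.

private
  variable
    X Y : Set
    n k l : ℕ

-- Growth of s^⟨2⟩

-- The numbers of monomials of degree 2 and 3 in `n` variables are `tri n` and `tet n`; both
-- recursions split by divisibility by the first variable.
tri : ℕ → ℕ
tri zero    = 0
tri (suc n) = suc n + tri n

tet : ℕ → ℕ
tet zero    = 0
tet (suc n) = tri (suc n) + tet n

tri≡C : ∀ n → suc n C 2 ≡ tri n
tri≡C zero    = refl
tri≡C (suc n) = trans (sym (nCk+nC[k+1]≡[n+1]C[k+1] (suc n) 1))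
                      (cong₂ _+_ (nC1≡n (suc n)) (tri≡C n))

tet≡C : ∀ n → suc (suc n) C 3 ≡ tet n
tet≡C zero    = refl
tet≡C (suc n) = trans (sym (nCk+nC[k+1]≡[n+1]C[k+1] (suc (suc n)) 2))
                      (cong₂ _+_ (tri≡C (suc n)) (tet≡C n))

tri-mono : ∀ {m n} → m ≤ n → tri m ≤ tri n
tri-mono z≤n     = z≤n
tri-mono (s≤s p) = +-mono-≤ (s≤s p) (tri-mono p)

n≤tri : ∀ n → n ≤ tri n
n≤tri zero    = z≤n
n≤tri (suc n) = m≤m+n (suc n) (tri n)

tri-+ : ∀ m n → tri (m + n) ≡ tri m + tri n + m * n
tri-+ zero    n = sym (+-identityʳ (tri n))
tri-+ (suc m) n = trans (cong (suc (m + n) +_) (tri-+ m n)) (lem m n (tri m) (tri n))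
  where
  lem : ∀ m n x y → suc (m + n) + (x + y + m * n) ≡ suc m + x + y + (n + m * n)
  lem = solve-∀

maxK-≡ : ∀ n d B k → k ≤ B → k C d ≤ n → (∀ j → k < j → n < j C d) → maxK n d B ≡ k
maxK-≡ n d zero    .zero z≤n _ _ = refl
maxK-≡ n d (suc B) k k≤B fits above with suc B C d ≤? n
... | yes fits′ = ≤-antisym (≮⇒≥ λ k<B → <⇒≱ (above (suc B) k<B) fits′) k≤B
... | no ¬fits with m≤n⇒m<n∨m≡n k≤B
...   | inj₁ (s≤s k≤B′) = maxK-≡ n d B k k≤B′ fits above
...   | inj₂ refl       = contradiction fits ¬fits

macaulayUp-0 : ∀ n → macaulayUp n 0 ≡ 0
macaulayUp-0 zero    = refl
macaulayUp-0 (suc n) = refl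

macaulayUp-1 : ∀ n → macaulayUp n 1 ≡ tri n
macaulayUp-1 zero    = refl
macaulayUp-1 (suc n)
  rewrite maxK-≡ (suc n) 1 (suc n + 1) (suc n) (m≤m+n (suc n) 1) (≤-reflexive (nC1≡n (suc n)))
            (λ j lt → subst (suc n <_) (sym (nC1≡n j)) lt)
        | tri≡C (suc n) | macaulayUp-0 (suc n ∸ suc n C 1) = +-identityʳ _

-- s^⟨2⟩; opaque because unfolding the Macaulay expansion of a sum makes type checking explode.
opaque
  F : ℕ → ℕ
  F s = macaulayUp s 2

  F-unfold : ∀ s → F s ≡ macaulayUp s 2
  F-unfold s = refl

-- Raising the top of the binomial by one would add `suc (suc A)`, which is more than the remainder
-- `b`.
maxK-tri : ∀ A b → b ≤ suc A → maxK (tri (suc A) + b) 2 (tri (suc A) + b + 2) ≡ suc (suc A)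
maxK-tri A b b≤A = maxK-≡ (tri (suc A) + b) 2 (tri (suc A) + b + 2) (suc (suc A))
  (subst (_≤ tri (suc A) + b + 2) (+-comm (suc A) 1)
    (+-mono-≤ (≤-trans (n≤tri (suc A)) (m≤m+n _ b)) (s≤s z≤n)))
  (subst (_≤ tri (suc A) + b) (sym (tri≡C (suc A))) (m≤m+n _ b))
  above
  where
  above : ∀ j → suc (suc A) < j → tri (suc A) + b < j C 2
  above (suc j) (s≤s A<j) = subst (tri (suc A) + b <_) (sym (tri≡C j))
    (≤-trans (subst (_≤ tri (suc (suc A))) (cong suc (+-comm b (tri (suc A))))
                (+-monoˡ-≤ (tri (suc A)) (s≤s b≤A)))
             (tri-mono A<j))

F-block₀ : ∀ A b → b ≤ A → F (tri A + b) ≡ tet A + tri b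
F-block₀ zero    .zero z≤n = F-unfold 0
F-block₀ (suc A) b     b≤A
  rewrite F-unfold (tri (suc A) + b) | maxK-tri A b b≤A | tet≡C (suc A) | tri≡C (suc A)
        | m+n∸m≡n (tri (suc A)) b | macaulayUp-1 b = refl

-- At `b ≡ suc A` the expansion jumps to the next block, but the formula persists because
-- `tet (suc A)` is `tri (suc A) + tet A`. The overlap lets later steps reach the end of a block
-- without a case split.
F-block : ∀ A b → b ≤ suc A → F (tri A + b) ≡ tet A + tri b
F-block A b b≤A with m≤n⇒m<n∨m≡n b≤A
... | inj₁ (s≤s b≤A′) = F-block₀ A b b≤A′
... | inj₂ refl       = trans (cong F (trans (+-comm (tri A) (suc A)) (sym (+-identityʳ _))))
                          (trans (F-block₀ (suc A) 0 z≤n)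
                            (trans (+-identityʳ _) (+-comm (tri (suc A)) (tet A))))

block : ∀ s → ∃[ A ] ∃[ b ] (b ≤ A × s ≡ tri A + b)
block zero = 0 , 0 , z≤n , refl
block (suc s) with block s
... | A , b , b≤A , refl with m≤n⇒m<n∨m≡n b≤A
...   | inj₁ b<A  = A , suc b , b<A , sym (+-suc (tri A) b)
...   | inj₂ refl = suc A , 0 , z≤n ,
                    trans (cong suc (+-comm (tri A) A)) (sym (+-identityʳ _))

F-suc : ∀ s → F s < F (suc s)
F-suc s with block s
... | A , b , b≤A , refl
  rewrite F-block A b (m≤n⇒m≤1+n b≤A) | sym (+-suc (tri A) b) | F-block A (suc b) (s≤s b≤A) =
  +-monoʳ-< (tet A) (m<n+m (tri b) (s≤s z≤n))

-- In other words `F s ∸ s` never drops, so having fewer irreducible monomials than permitted cannot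
-- raise the bound on relations.
F-growth : ∀ s k → k + F s ≤ F (k + s)
F-growth s zero    = ≤-refl
F-growth s (suc k) = ≤-trans (s≤s (F-growth s k)) (F-suc (k + s))

F-mono : ∀ {m n} → m ≤ n → F m ≤ F n
F-mono {m} m≤n with m≤n⇒∃[o]m+o≡n m≤n
... | k , refl = ≤-trans (m≤n+m (F m) k) (subst (λ z → k + F m ≤ F z) (+-comm k m) (F-growth m k))

tri-step : ∀ {d b} → d < b → tri d + b ≤ tri b
tri-step {d} {suc b} (s≤s d≤b) = subst (_≤ tri (suc b)) (+-comm (suc b) (tri d)) (+-monoʳ-≤ (suc b) (tri-mono d≤b))

-- The arithmetic behind the induction on variables in `macaulay-bound`: `s₀` and `p` count the
-- members of `S` avoiding and containing the first variable, and `x` the members of `L` containing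
-- it. Neither bound on `x` suffices alone.
F-gap : ∀ s₀ p x → x ≤ s₀ + p → x ≤ tri p → F s₀ + x ≤ F (s₀ + p)
F-gap s₀ p x x≤s x≤tri with block (s₀ + p)
... | A , b , b≤A , eq with ≤-total p b
-- Here `s₀` stays in the block of `s₀ + p`, so only the linear part of the expansion changes, and
-- `tri d + tri p ≤ tri (p + d)` suffices.
...   | inj₁ p≤b with m≤n⇒∃[o]m+o≡n p≤b
...     | d , refl = begin
          F s₀ + x              ≡⟨ cong (λ z → F z + x) s₀≡ ⟩
          F (tri A + d) + x     ≡⟨ cong (_+ x) (F-block A d (m≤n⇒m≤1+n (≤-trans (m≤n+m d p) b≤A))) ⟩
          tet A + tri d + x     ≤⟨ +-monoʳ-≤ (tet A + tri d) x≤tri ⟩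
          tet A + tri d + tri p ≤⟨ m≤m+n _ (p * d) ⟩
          tet A + tri d + tri p + p * d ≡⟨ lem (tet A) (tri d) (tri p) (p * d) ⟩
          tet A + (tri p + tri d + p * d) ≡⟨ cong (tet A +_) (sym (tri-+ p d)) ⟩
          tet A + tri (p + d)   ≡⟨ sym (F-block A (p + d) (m≤n⇒m≤1+n b≤A)) ⟩
          F (tri A + (p + d))   ≡⟨ cong F (sym eq) ⟩
          F (s₀ + p)            ∎
  where
  open ≤-Reasoning
  lem : ∀ x y z w → x + y + z + w ≡ x + (z + y + w)
  lem = solve-∀
  s₀≡ : s₀ ≡ tri A + d
  s₀≡ = +-cancelʳ-≡ p s₀ (tri A + d)
          (trans eq (trans (cong (tri A +_) (+-comm p d)) (sym (+-assoc (tri A) d p))))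
F-gap s₀ p x x≤s x≤tri | A , b , b≤A , eq | inj₂ b≤p with m≤n⇒∃[o]m+o≡n b≤p
... | q , refl = go A b≤A (+-cancelʳ-≡ b _ _ (trans (lem s₀ q b) eq)) (subst (x ≤_) eq x≤s)
                    (trans (cong F eq) (F-block A b (m≤n⇒m≤1+n b≤A)))
  where
  lem : ∀ s q b → s + q + b ≡ s + (b + q)
  lem = solve-∀
  go : ∀ A → b ≤ A → s₀ + q ≡ tri A → x ≤ tri A + b → F (s₀ + (b + q)) ≡ tet A + tri b →
       F s₀ + x ≤ F (s₀ + (b + q))
  go zero z≤n eq′ x≤ e rewrite e | m+n≡0⇒m≡0 s₀ eq′ | F-unfold 0 = x≤
  go (suc A) b≤A eq′ x≤ e with ≤-total q (suc A)
  -- A whole block is lost, so `F s₀` is at most `tet A`, and the linear bound on `x` covers the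
  -- difference.
  ... | inj₂ A≤q = begin
        F s₀ + x              ≤⟨ +-mono-≤ (F-mono s₀≤) x≤ ⟩
        F (tri A + 0) + (tri (suc A) + b) ≡⟨ cong (_+ (tri (suc A) + b)) (F-block A 0 z≤n) ⟩
        tet A + 0 + (tri (suc A) + b) ≤⟨ +-monoʳ-≤ (tet A + 0) (+-monoʳ-≤ (tri (suc A)) (n≤tri b)) ⟩
        tet A + 0 + (tri (suc A) + tri b) ≡⟨ lem₂ (tet A) (tri (suc A)) (tri b) ⟩
        tri (suc A) + tet A + tri b ≡⟨ sym e ⟩
        F (s₀ + (b + q)) ∎
    where
    open ≤-Reasoning
    lem₂ : ∀ x y z → x + 0 + (y + z) ≡ y + x + z
    lem₂ = solve-∀
    s₀≤ : s₀ ≤ tri A + 0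
    s₀≤ = subst (s₀ ≤_) (sym (+-identityʳ (tri A)))
            (+-cancelʳ-≤ (suc A) s₀ (tri A)
              (≤-trans (+-monoʳ-≤ s₀ A≤q) (≤-reflexive (trans eq′ (+-comm (suc A) (tri A))))))
  ... | inj₁ q≤A with m≤n⇒∃[o]m+o≡n q≤A
  ...   | d , q≡ = begin
        F s₀ + x              ≡⟨ cong (_+ x) (trans (cong F s₀≡) (F-block A d d≤A)) ⟩
        tet A + tri d + x     ≡⟨ +-assoc (tet A) (tri d) x ⟩
        tet A + (tri d + x)   ≤⟨ +-monoʳ-≤ (tet A) bound ⟩
        tet A + (tri (suc A) + tri b) ≡⟨ lem₂ (tet A) (tri (suc A)) (tri b) ⟩
        tri (suc A) + tet A + tri b ≡⟨ sym e ⟩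
        F (s₀ + (b + q)) ∎
    where
    open ≤-Reasoning
    lem₂ : ∀ x y z → x + (y + z) ≡ y + x + z
    lem₂ = solve-∀
    lem₃ : ∀ x y z w → x + (y + z + w) ≡ (z + x + w) + y
    lem₃ = solve-∀
    lem₄ : ∀ a b d → d + (a + b) ≡ a + (d + b)
    lem₄ = solve-∀
    d≤A : d ≤ suc A
    d≤A = subst (d ≤_) q≡ (m≤n+m d q)
    s₀≡ : s₀ ≡ tri A + d
    s₀≡ = +-cancelʳ-≡ q s₀ (tri A + d)
            (trans eq′ (trans (cong (_+ tri A) (sym q≡))
              (trans (+-comm (q + d) (tri A)) (trans (cong (tri A +_) (+-comm q d)) (sym (+-assoc (tri A) d q))))))
    bound : tri d + x ≤ tri (suc A) + tri b
    -- The quadratic bound on `x` works when `b ≤ d`, the linear one when `d < b`.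
    bound with b ≤? d
    ... | yes b≤d = begin
          tri d + x                             ≤⟨ +-monoʳ-≤ (tri d) x≤tri ⟩
          tri d + tri (b + q)                   ≡⟨ cong (tri d +_) (tri-+ b q) ⟩
          tri d + (tri b + tri q + b * q)       ≤⟨ +-monoʳ-≤ (tri d) (+-monoʳ-≤ (tri b + tri q) (≤-trans (*-monoˡ-≤ q b≤d) (≤-reflexive (*-comm d q)))) ⟩
          tri d + (tri b + tri q + q * d)       ≡⟨ lem₃ (tri d) (tri b) (tri q) (q * d) ⟩
          tri q + tri d + q * d + tri b         ≡⟨ cong (_+ tri b) (trans (sym (tri-+ q d)) (cong tri q≡)) ⟩
          tri (suc A) + tri b ∎
    ... | no b≰d = begin
          tri d + x                 ≤⟨ +-monoʳ-≤ (tri d) x≤ ⟩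
          tri d + (tri (suc A) + b) ≡⟨ lem₄ (tri (suc A)) b (tri d) ⟩
          tri (suc A) + (tri d + b) ≤⟨ +-monoʳ-≤ (tri (suc A)) (tri-step (≰⇒> b≰d)) ⟩
          tri (suc A) + tri b ∎

-- Counting with duplicate-free lists

length-split : {P : X → Set} (P? : Decidable P) (xs : List X) →
               length (filter P? xs) + length (filter (∁? P?) xs) ≡ length xs
length-split P? [] = refl
length-split P? (x ∷ xs) with P? x
... | yes _ = cong suc (length-split P? xs)
... | no  _ = trans (+-suc _ _) (cong suc (length-split P? xs))

∈-skip : ∀ {x y : X} as {bs} → y ∈ as ++ x ∷ bs → y ≢ x → y ∈ as ++ bs
∈-skip as y∈ y≢x with ∈-++⁻ as y∈
... | inj₁ y∈as         = ∈-++⁺ˡ y∈as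
... | inj₂ (here y≡x)   = contradiction y≡x y≢x
... | inj₂ (there y∈bs) = ∈-++⁺ʳ as y∈bs

length-insert : ∀ (as : List X) {x bs} → length (as ++ x ∷ bs) ≡ suc (length (as ++ bs))
length-insert []       = refl
length-insert (_ ∷ as) = cong suc (length-insert as)

unique-length-≤ : {xs ys : List X} → Unique xs → (∀ {x} → x ∈ xs → x ∈ ys) → length xs ≤ length ys
unique-length-≤ {xs = []} _ _ = z≤n
unique-length-≤ {xs = x ∷ xs} (x∉ ∷ xs!) xs⊆ys with ∈-∃++ (xs⊆ys (here refl))
... | as , bs , refl = subst (suc (length xs) ≤_) (sym (length-insert as))
  (s≤s (unique-length-≤ xs! λ y∈ → ∈-skip as (xs⊆ys (there y∈)) (λ { refl → All.lookup x∉ y∈ refl })))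

unique-map : (f : X → Y) {xs : List X} → (∀ {x y} → x ∈ xs → y ∈ xs → f x ≡ f y → x ≡ y) →
             Unique xs → Unique (map f xs)
unique-map f inj [] = []
unique-map f inj (x∉ ∷ xs!) =
  All.map⁺ (All.tabulate λ y∈ fx≡fy → All.lookup x∉ y∈ (inj (here refl) (there y∈) fx≡fy))
  ∷ unique-map f (λ x∈ y∈ → inj (there x∈) (there y∈)) xs!

injection-length-≤ : (f : X → Y) {xs : List X} {ys : List Y} → Unique xs →
                     (∀ {x y} → x ∈ xs → y ∈ xs → f x ≡ f y → x ≡ y) →
                     (∀ {x} → x ∈ xs → f x ∈ ys) → length xs ≤ length ys
injection-length-≤ f {xs} {ys} xs! inj f∈ =
  subst (_≤ length ys) (length-map f xs)
    (unique-length-≤ (unique-map f inj xs!)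
      (λ fx∈ → let x , x∈ , eq = ∈-map⁻ f fx∈ in subst (_∈ ys) (sym eq) (f∈ x∈)))

-- Order ideals of monomials

0v : Vec ℕ n
0v = replicate _ 0

unit : Fin n → Vec ℕ n
unit fzero    = 1 ∷ 0v
unit (fsuc i) = 0 ∷ unit i

⊕-comm : (a b : Vec ℕ n) → a ⊕ b ≡ b ⊕ a
⊕-comm = zipWith-comm +-comm

⊕-assoc : (a b c : Vec ℕ n) → (a ⊕ b) ⊕ c ≡ a ⊕ (b ⊕ c)
⊕-assoc = zipWith-assoc +-assoc

⊕-identityˡ : (a : Vec ℕ n) → 0v ⊕ a ≡ a
⊕-identityˡ = zipWith-identityˡ (λ _ → refl)

⊕-identityʳ : (a : Vec ℕ n) → a ⊕ 0v ≡ a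
⊕-identityʳ = zipWith-identityʳ +-identityʳ

⊕-swap : (a b c : Vec ℕ n) → a ⊕ (b ⊕ c) ≡ b ⊕ (a ⊕ c)
⊕-swap a b c = trans (sym (⊕-assoc a b c)) (trans (cong (_⊕ c) (⊕-comm a b)) (⊕-assoc b a c))

⊕-cancelʳ : (a b c : Vec ℕ n) → a ⊕ c ≡ b ⊕ c → a ≡ b
⊕-cancelʳ []      []      []      _  = refl
⊕-cancelʳ (x ∷ a) (y ∷ b) (z ∷ c) eq =
  cong₂ _∷_ (+-cancelʳ-≡ z x y (cong head eq)) (⊕-cancelʳ a b c (cong tail eq))

shuffle : ∀ a b c d → a + b + (c + d) ≡ a + c + (b + d)
shuffle = solve-∀

sum-⊕ : (a b : Vec ℕ n) → sum (a ⊕ b) ≡ sum a + sum b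
sum-⊕ []      []      = refl
sum-⊕ (x ∷ a) (y ∷ b) = trans (cong (x + y +_) (sum-⊕ a b)) (shuffle x y (sum a) (sum b))

sum-0v : ∀ n → sum (0v {n}) ≡ 0
sum-0v zero    = refl
sum-0v (suc n) = sum-0v n

sum-unit : (i : Fin n) → sum (unit i) ≡ 1
sum-unit {suc n} fzero = cong suc (sum-0v n)
sum-unit (fsuc i)      = sum-unit i

sum≡0⇒0v : (a : Vec ℕ n) → sum a ≡ 0 → a ≡ 0v
sum≡0⇒0v []         _  = refl
sum≡0⇒0v (zero ∷ a) eq = cong (0 ∷_) (sum≡0⇒0v a eq)

sum-unit-⊕ : (i : Fin n) (u : Vec ℕ n) → sum (unit i ⊕ u) ≡ suc (sum u)
sum-unit-⊕ i u = trans (sum-⊕ (unit i) u) (cong (_+ sum u) (sum-unit i))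

factor-unit : (a : Vec ℕ n) → 1 ≤ sum a → ∃[ i ] ∃[ u ] a ≡ unit i ⊕ u
factor-unit (suc x ∷ a) _ = fzero , x ∷ a , cong (suc x ∷_) (sym (⊕-identityˡ a))
factor-unit (zero ∷ a)  p with factor-unit a p
... | i , u , refl = fsuc i , 0 ∷ u , refl

sum≡1⇒unit : (a : Vec ℕ n) → sum a ≡ 1 → ∃[ i ] a ≡ unit i
sum≡1⇒unit a eq with factor-unit a (≤-reflexive (sym eq))
... | i , u , refl = i , trans (cong (unit i ⊕_) (sum≡0⇒0v u (suc-injective (trans (sym (sum-unit-⊕ i u)) eq))))
                               (⊕-identityʳ (unit i))

bump : Vec ℕ (suc n) → Vec ℕ (suc n)
bump (x ∷ a) = suc x ∷ a

bump-injective : {a b : Vec ℕ (suc n)} → bump a ≡ bump b → a ≡ b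
bump-injective {a = _ ∷ _} {_ ∷ _} refl = refl

bump≡unit⊕ : (a : Vec ℕ (suc n)) → bump a ≡ unit fzero ⊕ a
bump≡unit⊕ (x ∷ a) = cong (suc x ∷_) (sym (⊕-identityˡ a))

-- The quotients by each variable that occurs. Every proper divisor divides one of them, so in an
-- order ideal they stand for all proper divisors.
preds : Vec ℕ n → List (Vec ℕ n)
preds []          = []
preds (zero  ∷ a) = map (0 ∷_) (preds a)
preds (suc x ∷ a) = (x ∷ a) ∷ map (suc x ∷_) (preds a)

∈-preds⁺ : (i : Fin n) (u : Vec ℕ n) → u ∈ preds (unit i ⊕ u)
∈-preds⁺ fzero    (x ∷ u)     rewrite ⊕-identityˡ u = here refl
∈-preds⁺ (fsuc i) (zero ∷ u)  = ∈-map⁺ (0 ∷_) (∈-preds⁺ i u)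
∈-preds⁺ (fsuc i) (suc x ∷ u) = there (∈-map⁺ (suc x ∷_) (∈-preds⁺ i u))

∈-preds⁻ : (a : Vec ℕ n) {u : Vec ℕ n} → u ∈ preds a → ∃[ i ] a ≡ unit i ⊕ u
∈-preds⁻ (zero ∷ a) u∈ with ∈-map⁻ (0 ∷_) u∈
... | v , v∈ , refl with ∈-preds⁻ a v∈
...   | i , refl = fsuc i , refl
∈-preds⁻ (suc x ∷ a) (here refl) = fzero , cong (suc x ∷_) (sym (⊕-identityˡ a))
∈-preds⁻ (suc x ∷ a) (there u∈) with ∈-map⁻ (suc x ∷_) u∈
... | v , v∈ , refl with ∈-preds⁻ a v∈
...   | i , refl = fsuc i , refl

mons : (n d : ℕ) → List (Vec ℕ n)
mons zero    zero    = [] ∷ []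
mons zero    (suc d) = []
mons (suc n) zero    = map (0 ∷_) (mons n zero)
mons (suc n) (suc d) = map (0 ∷_) (mons n (suc d)) ++ map bump (mons (suc n) d)

∈-mons⁺ : (a : Vec ℕ n) → a ∈ mons n (sum a)
∈-mons⁺ []      = here refl
∈-mons⁺ (x ∷ a) = go x
  where
  zero-head : ∀ d → a ∈ mons _ d → 0 ∷ a ∈ mons _ d
  zero-head zero    a∈ = ∈-map⁺ (0 ∷_) a∈
  zero-head (suc d) a∈ = ∈-++⁺ˡ (∈-map⁺ (0 ∷_) a∈)
  go : ∀ x → x ∷ a ∈ mons _ (x + sum a)
  go zero    = zero-head (sum a) (∈-mons⁺ a)
  go (suc x) = ∈-++⁺ʳ _ (∈-map⁺ bump (go x))

∈-mons⁻ : ∀ n d {a : Vec ℕ n} → a ∈ mons n d → sum a ≡ d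
∈-mons⁻ zero    zero    (here refl) = refl
∈-mons⁻ (suc n) zero    a∈ with ∈-map⁻ (0 ∷_) a∈
... | v , v∈ , refl = ∈-mons⁻ n zero v∈
∈-mons⁻ (suc n) (suc d) a∈ with ∈-++⁻ (map (0 ∷_) (mons n (suc d))) a∈
... | inj₁ a∈₀ with ∈-map⁻ (0 ∷_) a∈₀
...   | v , v∈ , refl = ∈-mons⁻ n (suc d) v∈
∈-mons⁻ (suc n) (suc d) a∈ | inj₂ a∈₁ with ∈-map⁻ bump a∈₁
... | x ∷ v , v∈ , refl = cong suc (∈-mons⁻ (suc n) d v∈)

∷-injective : ∀ {x} {a b : Vec ℕ n} → _≡_ {A = Vec ℕ (suc n)} (x ∷ a) (x ∷ b) → a ≡ b
∷-injective refl = refl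

mons-unique : ∀ n d → Unique (mons n d)
mons-unique zero    zero    = [] ∷ []
mons-unique zero    (suc d) = []
mons-unique (suc n) zero    = Unique.map⁺ ∷-injective (mons-unique n zero)
mons-unique (suc n) (suc d) =
  Unique.++⁺ (Unique.map⁺ ∷-injective (mons-unique n (suc d)))
             (Unique.map⁺ bump-injective (mons-unique (suc n) d)) disjoint
  where
  disjoint : ∀ {a} → a ∈ map (0 ∷_) (mons n (suc d)) × a ∈ map bump (mons (suc n) d) → ⊥
  disjoint (a∈₀ , a∈₁) with ∈-map⁻ (0 ∷_) a∈₀ | ∈-map⁻ bump a∈₁
  ... | _ , _ , refl | _ ∷ _ , _ , ()

length-mons-suc : ∀ n d → length (mons (suc n) (suc d)) ≡ length (mons n (suc d)) + length (mons (suc n) d)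
length-mons-suc n d = trans (length-++ (map (0 ∷_) (mons n (suc d))))
  (cong₂ _+_ (length-map (0 ∷_) (mons n (suc d))) (length-map bump (mons (suc n) d)))

length-mons-0 : ∀ n → length (mons n 0) ≡ 1
length-mons-0 zero    = refl
length-mons-0 (suc n) = trans (length-map (0 ∷_) (mons n 0)) (length-mons-0 n)

length-mons-1 : ∀ n → length (mons n 1) ≡ n
length-mons-1 zero    = refl
length-mons-1 (suc n) = trans (length-mons-suc n 0)
  (trans (cong₂ _+_ (length-mons-1 n) (length-mons-0 (suc n))) (+-comm n 1))

length-mons-2 : ∀ n → length (mons n 2) ≡ tri n
length-mons-2 zero    = refl
length-mons-2 (suc n) = trans (length-mons-suc n 1)
  (trans (cong₂ _+_ (length-mons-2 n) (length-mons-1 (suc n))) (+-comm (tri n) (suc n)))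

length-mons-3 : ∀ n → length (mons n 3) ≡ tet n
length-mons-3 zero    = refl
length-mons-3 (suc n) = trans (length-mons-suc n 2)
  (trans (cong₂ _+_ (length-mons-3 n) (length-mons-2 (suc n))) (+-comm (tet n) (tri (suc n))))

-- One entry for each unordered pair, repetition allowed: the quadratic bound in `F-gap` is `tri p`,
-- not `p * p`.
pairSums : List (Vec ℕ n) → List (Vec ℕ n)
pairSums []       = []
pairSums (a ∷ as) = map (a ⊕_) (a ∷ as) ++ pairSums as

length-pairSums : (as : List (Vec ℕ n)) → length (pairSums as) ≡ tri (length as)
length-pairSums []       = refl
length-pairSums (a ∷ as) = trans (length-++ (map (a ⊕_) (a ∷ as)))
  (cong₂ _+_ (length-map (a ⊕_) (a ∷ as)) (length-pairSums as))

∈-pairSums : (as : List (Vec ℕ n)) {u v : Vec ℕ n} → u ∈ as → v ∈ as → u ⊕ v ∈ pairSums as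
∈-pairSums (a ∷ as) (here refl) v∈          = ∈-++⁺ˡ (∈-map⁺ (a ⊕_) v∈)
∈-pairSums (a ∷ as) {u} (there u∈) (here refl) =
  subst (_∈ pairSums (a ∷ as)) (⊕-comm a u) (∈-++⁺ˡ (∈-map⁺ (a ⊕_) (there u∈)))
∈-pairSums (a ∷ as) (there u∈) (there v∈)  = ∈-++⁺ʳ (map (a ⊕_) (a ∷ as)) (∈-pairSums as u∈ v∈)

headZero? : Decidable {A = Vec ℕ (suc n)} (λ a → head a ≡ 0)
headZero? a = head a ≟ 0

-- The case r = 2 of Macaulay's bound, for an order ideal that need not be graded.
macaulay-bound : ∀ n (O : Vec ℕ n → Set) → (∀ u v → O (u ⊕ v) → O u) →
  ∀ S → (∀ u → O u → 2 ≤ sum u → u ∈ S) →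
  ∀ L → Unique L → (∀ {t} → t ∈ L → 3 ≤ sum t × All O (preds t)) →
  length L ≤ F (length S)
macaulay-bound zero O down S S-all [] L! L-new = z≤n
macaulay-bound zero O down S S-all ([] ∷ L) L! L-new with proj₁ (L-new (here refl))
... | ()
macaulay-bound (suc n) O down S S-all L L! L-new =
  subst₂ _≤_ (length-split headZero? L) (cong F (length-split headZero? S))
    (≤-trans (+-monoˡ-≤ (length L₁) ih) (F-gap (length S₀) (length S₁) (length L₁) L₁≤S L₁≤S₁²))
  where
  L₀ = filter headZero? L
  L₁ = filter (∁? headZero?) L
  S₀ = filter headZero? S
  S₁ = filter (∁? headZero?) S

  -- The monomials avoiding the first variable live in the slice of `O` at exponent 0, an order
  -- ideal in one variable fewer.
  ih : length L₀ ≤ F (length S₀)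
  ih = subst₂ _≤_ (length-map tail L₀) (cong F (length-map tail S₀))
    (macaulay-bound n (λ u → O (0 ∷ u)) (λ u v → down (0 ∷ u) (0 ∷ v))
      (map tail S₀)
      (λ u Ou 2≤u → ∈-map⁺ tail (∈-filter⁺ headZero? (S-all (0 ∷ u) Ou 2≤u) refl))
      (map tail L₀)
      (unique-map tail tail-inj (Unique.filter⁺ headZero? L!))
      new)
    where
    tail-inj : ∀ {a b} → a ∈ L₀ → b ∈ L₀ → tail a ≡ tail b → a ≡ b
    tail-inj {x ∷ a} {y ∷ b} a∈ b∈ refl
      with proj₂ (∈-filter⁻ headZero? {xs = L} a∈) | proj₂ (∈-filter⁻ headZero? {xs = L} b∈)
    ... | refl | refl = refl
    new : ∀ {t} → t ∈ map tail L₀ → 3 ≤ sum t × All (λ u → O (0 ∷ u)) (preds t)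
    new t∈ with ∈-map⁻ tail t∈
    ... | x ∷ t , t∈₀ , refl with ∈-filter⁻ headZero? {xs = L} t∈₀
    ...   | t∈L , refl = proj₁ (L-new t∈L) , All.map⁻ (proj₂ (L-new t∈L))

  lower : Vec ℕ (suc n) → Vec ℕ (suc n)
  lower (x ∷ a) = pred x ∷ a

  -- Dividing once by the first variable lands in `O` with degree still at least 2, hence in `S`.
  L₁≤S : length L₁ ≤ length S₀ + length S₁
  L₁≤S = subst (length L₁ ≤_) (sym (length-split headZero? S))
    (injection-length-≤ lower (Unique.filter⁺ (∁? headZero?) L!) inj lower∈)
    where
    inj : ∀ {a b} → a ∈ L₁ → b ∈ L₁ → lower a ≡ lower b → a ≡ b
    inj {x ∷ a} {y ∷ b} a∈ b∈ eq
      with x | y | proj₂ (∈-filter⁻ (∁? headZero?) {xs = L} a∈)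
                 | proj₂ (∈-filter⁻ (∁? headZero?) {xs = L} b∈) | eq
    ... | zero  | _     | x≢0 | _   | _    = contradiction refl x≢0
    ... | suc _ | zero  | _   | y≢0 | _    = contradiction refl y≢0
    ... | suc _ | suc _ | _   | _   | refl = refl
    lower∈ : ∀ {a} → a ∈ L₁ → lower a ∈ S
    lower∈ {zero ∷ a}  a∈ = contradiction refl (proj₂ (∈-filter⁻ (∁? headZero?) {xs = L} a∈))
    lower∈ {suc x ∷ a} a∈ with L-new (proj₁ (∈-filter⁻ (∁? headZero?) {xs = L} a∈))
    ... | 3≤ , O∷ ∷ _ = S-all (x ∷ a) O∷ (≤-pred 3≤)

  L₁≤S₁² : length L₁ ≤ tri (length S₁)
  L₁≤S₁² = subst (length L₁ ≤_) (length-pairSums S₁)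
    (injection-length-≤ bump (Unique.filter⁺ (∁? headZero?) L!) (λ _ _ → bump-injective) bump∈)
    where
    S₁-all : ∀ u → O (unit fzero ⊕ u) → 1 ≤ sum u → unit fzero ⊕ u ∈ S₁
    S₁-all u@(_ ∷ _) Ou 1≤u = ∈-filter⁺ (∁? headZero?)
      (S-all _ Ou (subst (2 ≤_) (sym (sum-unit-⊕ fzero u)) (s≤s 1≤u))) (λ ())
    -- With x the first variable, x · (x y v) = (x y)(x v) and both factors lie in S₁.
    split : ∀ w → (∀ i u → unit fzero ⊕ w ≡ unit i ⊕ u → O u) → 2 ≤ sum w →
            bump (unit fzero ⊕ w) ∈ pairSums S₁
    split w O-pred 2≤w with factor-unit w (≤-trans (s≤s z≤n) 2≤w)
    ... | i , u , refl with factor-unit u (≤-pred (subst (2 ≤_) (sum-unit-⊕ i u) 2≤w))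
    ...   | j , v , refl = subst (_∈ pairSums S₁) eq
              (∈-pairSums S₁
                (S₁-all (unit i) (down _ v (subst O (sym (⊕-assoc x (unit i) v)) O-xyv))
                        (≤-reflexive (sym (sum-unit i))))
                (S₁-all (unit j ⊕ v) (O-pred i _ (⊕-swap x (unit i) (unit j ⊕ v)))
                        (subst (1 ≤_) (sym (sum-unit-⊕ j v)) (s≤s z≤n))))
      where
      x = unit {suc n} fzero
      O-xyv : O (x ⊕ (unit i ⊕ v))
      O-xyv = O-pred j _ (trans (cong (x ⊕_) (⊕-swap (unit i) (unit j) v)) (⊕-swap x (unit j) (unit i ⊕ v)))
      eq : (x ⊕ unit i) ⊕ (x ⊕ (unit j ⊕ v)) ≡ bump (x ⊕ (unit i ⊕ (unit j ⊕ v)))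
      eq = trans (⊕-assoc x (unit i) _)
             (trans (cong (x ⊕_) (⊕-swap (unit i) x (unit j ⊕ v))) (sym (bump≡unit⊕ _)))
    bump∈ : ∀ {a} → a ∈ L₁ → bump a ∈ pairSums S₁
    bump∈ {zero ∷ a}  a∈ = contradiction refl (proj₂ (∈-filter⁻ (∁? headZero?) {xs = L} a∈))
    bump∈ {suc x ∷ a} a∈ with L-new (proj₁ (∈-filter⁻ (∁? headZero?) {xs = L} a∈))
    ... | 3≤ , O-preds = subst (λ t → bump t ∈ pairSums S₁) (sym (bump≡unit⊕ (x ∷ a)))
          (split (x ∷ a)
            (λ i u eq → All.lookup O-preds (subst (λ t → u ∈ preds t) (trans (sym eq) (sym (bump≡unit⊕ (x ∷ a)))) (∈-preds⁺ i u)))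
            (≤-pred 3≤))

-- The presentation given by the minimal reducible monomials

φ-⊕ : (g a b : Vec ℕ n) → φ g (a ⊕ b) ≡ φ g a + φ g b
φ-⊕ []      []      []      = refl
φ-⊕ (w ∷ g) (x ∷ a) (y ∷ b) = trans (cong₂ _+_ (*-distribʳ-+ w x y) (φ-⊕ g a b))
                                    (shuffle (x * w) (y * w) (φ g a) (φ g b))

φ-0v : (g : Vec ℕ n) → φ g 0v ≡ 0
φ-0v []      = refl
φ-0v (w ∷ g) = φ-0v g

φ-unit : (g : Vec ℕ n) (i : Fin n) → φ g (unit i) ≡ lookup g i
φ-unit (w ∷ g) fzero    = trans (cong₂ _+_ (+-identityʳ w) (φ-0v g)) (+-identityʳ w)
φ-unit (w ∷ g) (fsuc i) = φ-unit g i

sum≤φ : (g : Vec ℕ n) → (∀ i → 1 ≤ lookup g i) → ∀ a → sum a ≤ φ g a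
sum≤φ []      g>0 []      = z≤n
sum≤φ (w ∷ g) g>0 (x ∷ a) = +-mono-≤ (subst (_≤ x * w) (*-identityʳ x) (*-monoʳ-≤ x (g>0 fzero)))
                                     (sum≤φ g (g>0 ∘ fsuc) a)

φ≡0⇒0v : (g : Vec ℕ n) → (∀ i → 1 ≤ lookup g i) → ∀ a → φ g a ≡ 0 → a ≡ 0v
φ≡0⇒0v g g>0 a eq = sum≡0⇒0v a (n≤0⇒n≡0 (subst (sum a ≤_) eq (sum≤φ g g>0 a)))

factor-lookup : (i : Fin n) (a : Vec ℕ n) → lookup a i ≢ 0 → ∃[ u ] a ≡ unit i ⊕ u
factor-lookup fzero    (zero ∷ a)  a≢0 = contradiction refl a≢0
factor-lookup fzero    (suc x ∷ a) a≢0 = x ∷ a , cong (suc x ∷_) (sym (⊕-identityˡ a))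
factor-lookup (fsuc i) (x ∷ a)     a≢0 with factor-lookup i a a≢0
... | u , refl = x ∷ u , refl

UniquelyFactored : Vec ℕ n → Vec ℕ n → Set
UniquelyFactored g a = ∀ x → φ g x ≡ φ g a → x ≡ a

-- Two factorizations of `φ g a` would stay different after adding `b`.
UniquelyFactored-factor : (g a b : Vec ℕ n) → UniquelyFactored g (a ⊕ b) → UniquelyFactored g a
UniquelyFactored-factor g a b uf x eq =
  ⊕-cancelʳ x a b (uf (x ⊕ b) (trans (φ-⊕ g x b) (trans (cong (_+ φ g b) eq) (sym (φ-⊕ g a b)))))

minGens>0 : ∀ {e} {g : Vec ℕ (suc e)} → IsMinGens e g → ∀ i → 1 ≤ lookup g i
minGens>0 {g = g} (_ , minimal , _) i = n≢0⇒n>0 λ gᵢ≡0 →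
  minimal i (0v , lookup-replicate i 0 , trans (φ-0v g) (sym gᵢ≡0))

-- By minimality every factorization of a generator uses that generator, and positivity leaves no
-- room for anything else.
unit-uniquelyFactored : ∀ {e} {g : Vec ℕ (suc e)} → IsMinGens e g → ∀ i → UniquelyFactored g (unit i)
unit-uniquelyFactored {g = g} G@(_ , minimal , _) i x eq
  with factor-lookup i x (λ xᵢ≡0 → minimal i (x , xᵢ≡0 , trans eq (φ-unit g i)))
... | u , refl = trans (cong (unit i ⊕_) (φ≡0⇒0v g (minGens>0 G) u φu≡0)) (⊕-identityʳ (unit i))
  where
  φu≡0 : φ g u ≡ 0
  φu≡0 = +-cancelˡ-≡ (φ g (unit i)) _ 0 (trans (sym (φ-⊕ g (unit i) u)) (trans eq (sym (+-identityʳ _))))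

0v-uniquelyFactored : (g : Vec ℕ n) → (∀ i → 1 ≤ lookup g i) → UniquelyFactored g 0v
0v-uniquelyFactored g g>0 x eq = φ≡0⇒0v g g>0 x (trans eq (φ-0v g))

GenCong-sound : (g : Vec ℕ n) {R : List (Vec ℕ n × Vec ℕ n)} →
                (∀ {a b} → (a , b) ∈ R → φ g a ≡ φ g b) → ∀ {a b} → GenCong R a b → φ g a ≡ φ g b
GenCong-sound g R-sound (base ab∈)   = R-sound ab∈
GenCong-sound g R-sound refl′        = refl
GenCong-sound g R-sound (sym′ p)     = sym (GenCong-sound g R-sound p)
GenCong-sound g R-sound (trans′ p q) = trans (GenCong-sound g R-sound p) (GenCong-sound g R-sound q)
GenCong-sound g R-sound (plus {a} {b} {c} {d} p q) =
  trans (φ-⊕ g a c) (trans (cong₂ _+_ (GenCong-sound g R-sound p) (GenCong-sound g R-sound q)) (sym (φ-⊕ g b d)))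

-- Lexicographic comparison and monomials of bounded degree

infix 4 _≺_

_≺_ : Vec ℕ n → Vec ℕ n → Set
_≺_ = Lex-< _≡_ _<_

≺-irrefl : {a : Vec ℕ n} → ¬ a ≺ a
≺-irrefl = Lex.<-irrefl <-irrefl (≡⇒Pointwise-≡ refl)

≺-wellFounded : WellFounded (_≺_ {n})
≺-wellFounded = Lex.<-wellFounded trans (λ { refl → id }) ℕ-wellFounded

≺-⊕ : (a b c : Vec ℕ n) → a ≺ b → a ⊕ c ≺ b ⊕ c
≺-⊕ (_ ∷ _) (_ ∷ _) (z ∷ c) (this x<y _)    = this (+-monoˡ-< z x<y) refl
≺-⊕ (_ ∷ a) (_ ∷ b) (z ∷ c) (next refl a≺b) = next refl (≺-⊕ a b c a≺b)
≺-⊕ [] [] [] (Lex.base ())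

box : ∀ n → ℕ → List (Vec ℕ n)
box n zero    = mons n 0
box n (suc d) = mons n (suc d) ++ box n d

∈-box⁺ : (a : Vec ℕ n) (d : ℕ) → sum a ≤ d → a ∈ box n d
∈-box⁺ a zero    p = subst (λ k → a ∈ mons _ k) (n≤0⇒n≡0 p) (∈-mons⁺ a)
∈-box⁺ a (suc d) p with m≤n⇒m<n∨m≡n p
... | inj₁ (s≤s p′) = ∈-++⁺ʳ _ (∈-box⁺ a d p′)
... | inj₂ eq       = ∈-++⁺ˡ (subst (λ k → a ∈ mons _ k) eq (∈-mons⁺ a))

∈-box⁻ : ∀ d {a : Vec ℕ n} → a ∈ box n d → sum a ≤ d
∈-box⁻ zero    a∈ = ≤-reflexive (∈-mons⁻ _ 0 a∈)
∈-box⁻ (suc d) a∈ with ∈-++⁻ (mons _ (suc d)) a∈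
... | inj₁ a∈₁ = ≤-reflexive (∈-mons⁻ _ (suc d) a∈₁)
... | inj₂ a∈₂ = m≤n⇒m≤1+n (∈-box⁻ d a∈₂)

box-unique : ∀ n d → Unique (box n d)
box-unique n zero    = mons-unique n 0
box-unique n (suc d) = Unique.++⁺ (mons-unique n (suc d)) (box-unique n d)
  λ (a∈₁ , a∈₂) → <-irrefl (∈-mons⁻ n (suc d) a∈₁) (s≤s (∈-box⁻ d a∈₂))

%-≡⇒multiple : ∀ m .{{_ : NonZero m}} {a b} → a ≤ b → a % m ≡ b % m → ∃[ k ] k * m + a ≡ b
%-≡⇒multiple m {a} {b} a≤b eq = b / m ∸ a / m , (begin
  (b / m ∸ a / m) * m + a
    ≡⟨ cong₂ _+_ (*-distribʳ-∸ m (b / m) (a / m)) (m≡m%n+[m/n]*n a m) ⟩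
  (b / m * m ∸ a / m * m) + (a % m + a / m * m)
    ≡⟨ cong ((b / m * m ∸ a / m * m) +_) (+-comm (a % m) (a / m * m)) ⟩
  (b / m * m ∸ a / m * m) + (a / m * m + a % m)
    ≡⟨ sym (+-assoc (b / m * m ∸ a / m * m) (a / m * m) (a % m)) ⟩
  (b / m * m ∸ a / m * m) + a / m * m + a % m
    ≡⟨ cong₂ _+_ (m∸n+n≡m (*-monoˡ-≤ m (/-monoˡ-≤ m a≤b))) eq ⟩
  b / m * m + b % m
    ≡⟨ trans (+-comm (b / m * m) (b % m)) (sym (m≡m%n+[m/n]*n b m)) ⟩
  b ∎)
  where
  open ≡-Reasoning

-- A monomial a in the non-multiplicity generators is reducible when its residue class modulo m
-- contains a monomial of smaller value, or of the same value and lexicographically smaller; the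
-- irreducible monomials are thus a choice of one factorization for each Apéry element.
module Apéry {e : ℕ} (m : ℕ) (γ : Vec ℕ e) (G : IsMinGens e (m ∷ γ)) where

  g : Vec ℕ (suc e)
  g = m ∷ γ

  g>0 : ∀ i → 1 ≤ lookup g i
  g>0 = minGens>0 G

  instance
    m≢0 : NonZero m
    m≢0 = >-nonZero (g>0 fzero)

  infix 4 _⊏_

  -- With the value in front, one lexicographic comparison expresses both criteria, and
  -- well-foundedness and compatibility with `⊕` are inherited from `_≺_`.
  weighted : Vec ℕ e → Vec ℕ (suc e)
  weighted a = φ γ a ∷ a

  _⊏_ : Vec ℕ e → Vec ℕ e → Set
  a ⊏ b = weighted a ≺ weighted b

  ⊏⇒φ≤ : ∀ {a b} → a ⊏ b → φ γ a ≤ φ γ b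
  ⊏⇒φ≤ (this p _) = <⇒≤ p
  ⊏⇒φ≤ (next eq _) = ≤-reflexive eq

  ⊏-⊕ : ∀ a b c → a ⊏ b → a ⊕ c ⊏ b ⊕ c
  ⊏-⊕ a b c a⊏b = subst₂ (λ x y → (x ∷ a ⊕ c) ≺ (y ∷ b ⊕ c)) (sym (φ-⊕ γ a c)) (sym (φ-⊕ γ b c))
    (≺-⊕ (weighted a) (weighted b) (weighted c) a⊏b)

  Reducible : Vec ℕ e → Set
  Reducible a = ∃[ x ] (φ g x ≡ φ γ a × tail x ⊏ a)

  -- Generators are positive, so the degree of a witness is at most its value and a finite box can
  -- be searched.
  reducible? : Decidable Reducible
  reducible? a = map′ (λ w → let x , _ , p = find w in x , p)
    (λ (x , eq , p) → lose (∈-box⁺ x (φ γ a) (subst (sum x ≤_) eq (sum≤φ g g>0 x))) (eq , p))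
    (any? (λ x → (φ g x ≟ φ γ a) ×-dec Lex.<-decidable _≟_ _<?_ (weighted (tail x)) (weighted a))
          (box (suc e) (φ γ a)))

  Irreducible : Vec ℕ e → Set
  Irreducible a = ¬ Reducible a

  reducible-⊕ : ∀ a b → Reducible a → Reducible (a ⊕ b)
  reducible-⊕ a b (k ∷ x , eq , x⊏a) = k ∷ x ⊕ b ,
    trans (cong₂ _+_ (refl {x = k * m}) (φ-⊕ γ x b))
      (trans (sym (+-assoc (k * m) (φ γ x) (φ γ b)))
        (trans (cong (_+ φ γ b) eq) (sym (φ-⊕ γ a b)))) ,
    ⊏-⊕ x a b x⊏a

  irreducible-factor : ∀ a b → Irreducible (a ⊕ b) → Irreducible a
  irreducible-factor a b irr red = irr (reducible-⊕ a b red)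

  uniquelyFactored⇒irreducible : ∀ {a} → UniquelyFactored g (0 ∷ a) → Irreducible a
  uniquelyFactored⇒irreducible {a} uf (x , eq , x⊏a) = ≺-irrefl (subst (_⊏ a) (cong tail (uf x eq)) x⊏a)

  -- Monomials are comparable under `_⊏_`, and within a residue class the smaller one together with
  -- copies of `m` is a witness against the larger.
  irreducible-≡ : ∀ {a b} → Irreducible a → Irreducible b → φ γ a % m ≡ φ γ b % m → a ≡ b
  irreducible-≡ {a} {b} irrA irrB eq with Lex.<-cmp sym <-cmp (weighted a) (weighted b)
  ... | tri< a⊏b _ _ = let k , eq′ = %-≡⇒multiple m (⊏⇒φ≤ a⊏b) eq in contradiction (k ∷ a , eq′ , a⊏b) irrB
  ... | tri≈ _ a≈b _ = cong tail (Pointwise-≡⇒≡ a≈b)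
  ... | tri> _ _ b⊏a = let k , eq′ = %-≡⇒multiple m (⊏⇒φ≤ b⊏a) (sym eq) in contradiction (k ∷ b , eq′ , b⊏a) irrA

  irreducible-tail-≡ : ∀ x y → Irreducible (tail x) → Irreducible (tail y) → φ g x ≡ φ g y → x ≡ y
  irreducible-tail-≡ (k ∷ a) (l ∷ b) irrA irrB eq with irreducible-≡ irrA irrB (begin
      φ γ a % m           ≡⟨ sym ([m+kn]%n≡m%n (φ γ a) k m) ⟩
      (φ γ a + k * m) % m ≡⟨ cong (_% m) (trans (+-comm (φ γ a) (k * m)) (trans eq (+-comm (l * m) (φ γ b)))) ⟩
      (φ γ b + l * m) % m ≡⟨ [m+kn]%n≡m%n (φ γ b) l m ⟩
      φ γ b % m ∎)
    where
    open ≡-Reasoning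
  ... | refl = cong (_∷ a) (*-cancelʳ-≡ k l m (+-cancelʳ-≡ (φ γ a) (k * m) (l * m) eq))

  0v-irreducible : Irreducible 0v
  0v-irreducible = uniquelyFactored⇒irreducible (0v-uniquelyFactored g g>0)

  unit-irreducible : ∀ i → Irreducible (unit i)
  unit-irreducible i = uniquelyFactored⇒irreducible (unit-uniquelyFactored G (fsuc i))

  reducible⇒2≤sum : ∀ {a} → Reducible a → 2 ≤ sum a
  reducible⇒2≤sum {a} red with sum a in eq
  ... | 0           = contradiction (subst Reducible (sum≡0⇒0v a eq) red) 0v-irreducible
  ... | 1           = let i , a≡ = sum≡1⇒unit a eq in contradiction (subst Reducible a≡ red) (unit-irreducible i)
  ... | suc (suc k) = s≤s (s≤s z≤n)

  -- From this value on, subtracting `m` stays in the monoid, so there is a factorization containing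
  -- `m` and a smaller representative of the class. Hence the irreducible monomials can be listed.
  conductor : ℕ
  conductor = proj₁ (proj₂ (proj₂ G)) + m

  irreducible⇒sum<conductor : ∀ {a} → Irreducible a → sum a < conductor
  irreducible⇒sum<conductor {a} irr = ≤-<-trans (sum≤φ γ (g>0 ∘ fsuc) a) (≰⇒> large⇒⊥)
    where
    N = proj₁ (proj₂ (proj₂ G))
    large⇒⊥ : ¬ conductor ≤ φ γ a
    large⇒⊥ N+m≤ with proj₂ (proj₂ (proj₂ G)) (φ γ a ∸ m) (m+n≤o⇒m≤o∸n N N+m≤)
    ... | k ∷ x , eq = irr (suc k ∷ x , eq′ , this (<-≤-trans (m<n+m (φ γ x) (g>0 fzero)) φx+m≤) refl)
      where
      eq′ : m + k * m + φ γ x ≡ φ γ a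
      eq′ = trans (+-assoc m (k * m) (φ γ x)) (trans (cong (m +_) eq) (m+[n∸m]≡n (m+n≤o⇒n≤o N N+m≤)))
      φx+m≤ : m + φ γ x ≤ φ γ a
      φx+m≤ = subst (m + φ γ x ≤_) eq′ (+-monoˡ-≤ (φ γ x) (m≤m+n m (k * m)))

  irreducible-count : ∀ {as} → Unique as → (∀ {a} → a ∈ as → 2 ≤ sum a × Irreducible a) → suc e + length as ≤ m
  irreducible-count {as} as! as-irr = subst₂ _≤_ length≡ (length-upTo m)
    (injection-length-≤ (λ a → φ γ a % m) all!
      (λ a∈ b∈ → irreducible-≡ (all-irr a∈) (all-irr b∈))
      (λ {a} _ → ∈-upTo⁺ (m%n<n (φ γ a) m)))
    where
    low = mons e 0 ++ mons e 1
    low-sum : ∀ {a} → a ∈ low → sum a < 2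
    low-sum a∈ with ∈-++⁻ (mons e 0) a∈
    ... | inj₁ a∈₀ = subst (_< 2) (sym (∈-mons⁻ e 0 a∈₀)) (s≤s z≤n)
    ... | inj₂ a∈₁ = subst (_< 2) (sym (∈-mons⁻ e 1 a∈₁)) ≤-refl
    all! : Unique (low ++ as)
    all! = Unique.++⁺
      (Unique.++⁺ (mons-unique e 0) (mons-unique e 1)
        λ (a∈₀ , a∈₁) → contradiction (trans (sym (∈-mons⁻ e 0 a∈₀)) (∈-mons⁻ e 1 a∈₁)) λ ())
      as! λ (a∈₁ , a∈₂) → <⇒≱ (low-sum a∈₁) (proj₁ (as-irr a∈₂))
    all-irr : ∀ {a} → a ∈ low ++ as → Irreducible a
    all-irr a∈ with ∈-++⁻ low a∈
    ... | inj₁ a∈₁ = λ red → <⇒≱ (low-sum a∈₁) (reducible⇒2≤sum red)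
    ... | inj₂ a∈₂ = proj₂ (as-irr a∈₂)
    length≡ : length (low ++ as) ≡ suc e + length as
    length≡ = trans (length-++ low)
      (cong (_+ length as) (trans (length-++ (mons e 0)) (cong₂ _+_ (length-mons-0 e) (length-mons-1 e))))

  New : Vec ℕ e → Set
  New a = 2 ≤ sum a × All Irreducible (preds a)

  new? : Decidable New
  new? a = (2 ≤? sum a) ×-dec all? (∁? reducible?) (preds a)

  new corners irr₂ new₃ new₂ : List (Vec ℕ e)
  new     = filter new? (box e conductor)
  corners = filter reducible? new
  irr₂    = filter (∁? reducible?) new
  new₃    = filter (λ a → 3 ≤? sum a) new
  new₂    = filter (∁? (λ a → 3 ≤? sum a)) new

  new-unique : Unique new
  new-unique = Unique.filter⁺ new? (box-unique e conductor)

  ∈-new : ∀ {a} → New a → a ∈ new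
  ∈-new {a} a-new@(2≤a , irr) with factor-unit a (≤-trans (s≤s z≤n) 2≤a)
  ... | i , u , refl = ∈-filter⁺ new? (∈-box⁺ _ conductor
    (subst (_≤ conductor) (sym (sum-unit-⊕ i u)) (irreducible⇒sum<conductor (All.lookup irr (∈-preds⁺ i u))))) a-new

  new-New : ∀ {a} → a ∈ new → New a
  new-New a∈ = proj₂ (∈-filter⁻ new? {xs = box e conductor} a∈)

  irreducible⇒preds-irreducible : ∀ {a} → Irreducible a → All Irreducible (preds a)
  irreducible⇒preds-irreducible {a} irr = All.tabulate λ {u} u∈ →
    let i , a≡ = ∈-preds⁻ a u∈
    in irreducible-factor u (unit i) (subst Irreducible (trans a≡ (⊕-comm (unit i) u)) irr)

  -- By reducibility `new` splits into `corners` and `irr₂`, by degree into `new₃` and `new₂`. The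
  -- slack `k` between `irr₂` and `s` is absorbed by `F-growth`.
  length-corners : ∀ s → suc e + s ≡ m → length corners + s ≤ tri e + F s
  length-corners s m≡ with m≤n⇒∃[o]m+o≡n
    (+-cancelˡ-≤ (suc e) _ s (subst (suc e + length irr₂ ≤_) (sym m≡)
      (irreducible-count {irr₂} (Unique.filter⁺ (∁? reducible?) new-unique)
        λ a∈ → let a∈new , irr = ∈-filter⁻ (∁? reducible?) {xs = new} a∈ in proj₁ (new-New a∈new) , irr)))
  ... | k , refl = begin
      length corners + (length irr₂ + k)  ≡⟨ sym (+-assoc (length corners) _ k) ⟩
      length corners + length irr₂ + k    ≡⟨ cong (_+ k) (trans (length-split reducible? new)
                                               (sym (length-split (λ a → 3 ≤? sum a) new))) ⟩
      length new₃ + length new₂ + k       ≤⟨ +-monoˡ-≤ k (+-mono-≤ new₃≤ new₂≤) ⟩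
      F (length irr₂) + tri e + k         ≡⟨ trans (cong (_+ k) (+-comm (F (length irr₂)) (tri e)))
                                               (trans (+-assoc (tri e) _ k) (cong (tri e +_) (+-comm _ k))) ⟩
      tri e + (k + F (length irr₂))       ≤⟨ +-monoʳ-≤ (tri e) (F-growth (length irr₂) k) ⟩
      tri e + F (k + length irr₂)         ≡⟨ cong (λ s → tri e + F s) (+-comm k (length irr₂)) ⟩
      tri e + F (length irr₂ + k) ∎
    where
    open ≤-Reasoning
    new₃≤ : length new₃ ≤ F (length irr₂)
    new₃≤ = macaulay-bound e Irreducible irreducible-factor irr₂
      (λ u irr 2≤u → ∈-filter⁺ (∁? reducible?) (∈-new (2≤u , irreducible⇒preds-irreducible irr)) irr)
      new₃ (Unique.filter⁺ (λ a → 3 ≤? sum a) new-unique)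
      (λ t∈ → let t∈new , 3≤t = ∈-filter⁻ (λ a → 3 ≤? sum a) {xs = new} t∈ in 3≤t , proj₂ (new-New t∈new))
    new₂≤ : length new₂ ≤ tri e
    new₂≤ = subst (length new₂ ≤_) (length-mons-2 e)
      (unique-length-≤ (Unique.filter⁺ (∁? (λ a → 3 ≤? sum a)) new-unique) λ {a} a∈ →
        let a∈new , 3≰a = ∈-filter⁻ (∁? (λ a → 3 ≤? sum a)) {xs = new} a∈
        in subst (λ d → a ∈ mons e d) (≤-antisym (≤-pred (≰⇒> 3≰a)) (proj₁ (new-New a∈new))) (∈-mons⁺ a))

  -- A reducible monomial is paired with the witness found by `reducible?`; the trivial pair extends
  -- the function to all monomials while staying in the kernel.
  relation : Vec ℕ e → Vec ℕ (suc e) × Vec ℕ (suc e)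
  relation a with reducible? a
  ... | yes (x , _) = 0 ∷ a , x
  ... | no  _       = 0 ∷ a , 0 ∷ a

  relations : List (Vec ℕ (suc e) × Vec ℕ (suc e))
  relations = map relation corners

  relations-sound : ∀ {a b} → (a , b) ∈ relations → φ g a ≡ φ g b
  relations-sound ab∈ with ∈-map⁻ relation ab∈
  ... | d , _ , eq with reducible? d | eq
  ...   | yes (x , eq′ , _) | refl = sym eq′
  ...   | no _              | refl = refl

  -- Dividing by a variable as long as some quotient stays reducible ends at a corner; `k` bounds
  -- the degree, which drops each time.
  corner-below : ∀ k a → sum a ≤ k → Reducible a → ∃[ d ] ∃[ w ] (a ≡ d ⊕ w × d ∈ corners)
  corner-below k a a≤k red with any? reducible? (preds a)
  ... | no ¬red = a , 0v , sym (⊕-identityʳ a) ,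
        ∈-filter⁺ reducible? (∈-new (reducible⇒2≤sum red , All.¬Any⇒All¬ (preds a) ¬red)) red
  ... | yes w with find w
  ...   | u , u∈ , redU with ∈-preds⁻ a u∈
  corner-below zero a a≤k red | yes w | u , u∈ , redU | i , refl =
    contradiction (subst (_≤ 0) (sum-unit-⊕ i u) a≤k) λ ()
  corner-below (suc k) a a≤k red | yes w | u , u∈ , redU | i , refl
    with corner-below k u (≤-pred (subst (_≤ suc k) (sum-unit-⊕ i u) a≤k)) redU
  ...     | d , w′ , refl , d∈ = d , unit i ⊕ w′ , ⊕-swap (unit i) d w′ , d∈

  relation-corner : ∀ {d} → d ∈ corners → ∃[ x ] ((0 ∷ d , x) ∈ relations × tail x ⊏ d)
  relation-corner {d} d∈ with reducible? d in eq
  ... | no ¬red = contradiction (proj₂ (∈-filter⁻ reducible? {xs = new} d∈)) ¬red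
  ... | yes (x , _ , x⊏d) = x , subst (_∈ relations) rel≡ (∈-map⁺ relation d∈) , x⊏d
    where
    rel≡ : relation d ≡ (0 ∷ d , x)
    rel≡ rewrite eq = refl

  -- Rewriting with one relation at a time. The copies of `m` it produces are collected in the head,
  -- so the tail `x ⊕ w` left to rewrite is smaller under `_⊏_`.
  reduce : ∀ a → Acc _⊏_ a → ∃[ y ] (Irreducible (tail y) × GenCong relations (0 ∷ a) y)
  reduce a (acc rec) with reducible? a
  ... | no irr = 0 ∷ a , irr , refl′
  ... | yes red with corner-below (sum a) a ≤-refl red
  ...   | d , w , refl , d∈ with relation-corner d∈
  ...     | k ∷ x , dx∈ , x⊏d with reduce (x ⊕ w) (rec (⊏-⊕ x d w x⊏d))
  ...       | l ∷ y , irr , y-cong = (k + l) ∷ y , irr ,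
    trans′ (plus (base dx∈) (refl′ {a = 0 ∷ w}))
      (subst₂ (GenCong relations)
        (cong₂ _∷_ refl (⊕-identityˡ (x ⊕ w))) (cong₂ _∷_ refl (⊕-identityˡ y))
        (plus (refl′ {a = k ∷ 0v}) y-cong))

  normalForm : ∀ x → ∃[ y ] (Irreducible (tail y) × GenCong relations x y)
  normalForm (k ∷ a) with reduce a (On.wellFounded weighted ≺-wellFounded a)
  ... | l ∷ y , irr , y-cong = (k + l) ∷ y , irr ,
    subst₂ (GenCong relations)
      (cong₂ _∷_ (+-identityʳ k) (⊕-identityˡ a)) (cong₂ _∷_ refl (⊕-identityˡ y))
      (plus (refl′ {a = k ∷ 0v}) y-cong)

  -- Rewriting makes every factorization congruent to one with irreducible tail, and each fibre
  -- contains only one of those.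
  relations-generate : Generates g relations
  relations-generate a b = complete , GenCong-sound g relations-sound
    where
    complete : φ g a ≡ φ g b → GenCong relations a b
    complete eq with normalForm a | normalForm b
    ... | x , irrX , a~x | y , irrY , b~y = trans′ a~x (sym′ (subst (GenCong relations b) (sym x≡y) b~y))
      where
      x≡y : x ≡ y
      x≡y = irreducible-tail-≡ x y irrX irrY
        (trans (sym (GenCong-sound g relations-sound a~x)) (trans eq (GenCong-sound g relations-sound b~y)))

  length-relations : ∀ s → suc e + s ≡ m → length relations + s ≤ tri e + F s
  length-relations s m≡ = subst (λ k → k + s ≤ tri e + F s) (sym (length-map relation corners)) (length-corners s m≡)

-- Relations forced by isolated vertices

Crosses : {X : Set} → List X → X × X → Set
Crosses B (p , q) = (p ∈ B × q ∉ B) ⊎ (p ∉ B × q ∈ B)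

-- Deleting a crossing edge of the whole list together with its endpoint in the list preserves
-- the hypothesis.
crossing-count : {X : Set} → DecidableEquality X → ∀ k (L : List X) (R : List (X × X)) →
  length R ≡ k → Unique L →
  (∀ B {b} → b ∈ B → (∀ {x} → x ∈ B → x ∈ L) → ∃[ r ] (r ∈ R × Crosses B r)) →
  length L ≤ length R
crossing-count _≟ₓ_ k []         R k≡ L! crossed = z≤n
crossing-count {X} _≟ₓ_ k L@(_ ∷ _) R k≡ L! crossed
  with crossed L (here refl) id
... | r@(p , q) , r∈ , cross with ∈-∃++ r∈
crossing-count {X} _≟ₓ_ (suc k) L@(_ ∷ _) R k≡ L! crossed | r@(p , q) , r∈ , cross | R₁ , R₂ , refl =
  [ (λ (p∈ , q∉) → remove p (λ B⊆ → (λ p∈B → p∉L′ (B⊆ p∈B)) , λ q∈B → q∉ (L′⊆ p (B⊆ q∈B))))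
  , (λ (p∉ , q∈) → remove q (λ B⊆ → (λ p∈B → p∉ (L′⊆ q (B⊆ p∈B))) , λ q∈B → p∉L′ (B⊆ q∈B)))
  ]′ cross
  where
  ≢? : ∀ w → Decidable (λ x → x ≢ w)
  ≢? w x = ¬? (x ≟ₓ w)
  L′ : X → List X
  L′ w = filter (≢? w) L
  L′⊆ : ∀ w {x} → x ∈ L′ w → x ∈ L
  L′⊆ w x∈ = proj₁ (∈-filter⁻ (≢? w) {xs = L} x∈)
  p∉L′ : ∀ {w} → w ∉ L′ w
  p∉L′ {w} w∈ = proj₂ (∈-filter⁻ (≢? w) {xs = L} w∈) refl
  remove : ∀ w → (∀ {B} → (∀ {x} → x ∈ B → x ∈ L′ w) → p ∉ B × q ∉ B) →
           length L ≤ length (R₁ ++ r ∷ R₂)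
  remove w avoids = subst (length L ≤_) (sym (length-insert R₁))
    (≤-trans
      (unique-length-≤ {ys = w ∷ L′ w} L! λ {x} x∈ → keep x x∈)
      (s≤s (crossing-count _≟ₓ_ k (L′ w) (R₁ ++ R₂)
        (suc-injective (trans (sym (length-insert R₁)) k≡))
        (Unique.filter⁺ (≢? w) L!)
        λ B b∈ B⊆ → shrink B B⊆ (crossed B b∈ (L′⊆ w ∘ B⊆)))))
    where
    keep : ∀ x → x ∈ L → x ∈ w ∷ L′ w
    keep x x∈ with x ≟ₓ w
    ... | yes x≡w = here x≡w
    ... | no  x≢w = there (∈-filter⁺ (≢? w) x∈ x≢w)
    shrink : ∀ B → (∀ {x} → x ∈ B → x ∈ L′ w) → ∃[ r′ ] (r′ ∈ R₁ ++ r ∷ R₂ × Crosses B r′) →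
             ∃[ r′ ] (r′ ∈ R₁ ++ R₂ × Crosses B r′)
    shrink B B⊆ (r′ , r′∈ , cr) = r′ , ∈-skip R₁ r′∈ r′≢r , cr
      where
      r′≢r : r′ ≢ r
      r′≢r r′≡r = [ (λ (p∈B , _) → proj₁ (avoids B⊆) p∈B) , (λ (_ , q∈B) → proj₂ (avoids B⊆) q∈B) ]′
                    (subst (Crosses B) r′≡r cr)
crossing-count _≟ₓ_ zero L@(_ ∷ _) R k≡ L! crossed | r , r∈ , cross | R₁ , R₂ , refl =
  contradiction (trans (sym (length-insert R₁)) k≡) λ ()

module LowerBound {e : ℕ} (m : ℕ) (γ : Vec ℕ e) (G : IsMinGens e (m ∷ γ))
  (L : List (Vec ℕ e)) (L! : Unique L)
  (L-reducible : ∀ {a} → a ∈ L → Apéry.Reducible m γ G a)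
  (L-isolated : ∀ {a} → a ∈ L → ∀ i u → a ≡ unit i ⊕ u → UniquelyFactored (m ∷ γ) (0 ∷ u))
  (R : List (Vec ℕ (suc e) × Vec ℕ (suc e))) (R-gen : Generates (m ∷ γ) R) where

  open Apéry m γ G
  open DecMembership (≡-dec {n = suc e} _≟_) using (_∈?_)

  L⁺ : List (Vec ℕ (suc e))
  L⁺ = map (0 ∷_) L

  crosses? : ∀ B → Decidable (Crosses {Vec ℕ (suc e)} B)
  crosses? B (p , q) = ((p ∈? B) ×-dec ¬? (q ∈? B)) ⊎-dec (¬? (p ∈? B) ×-dec (q ∈? B))

  isolated : ∀ {b} → b ∈ L⁺ → ∀ u v → b ≡ u ⊕ v → v ≢ 0v → UniquelyFactored g u
  isolated b∈ u v eq v≢0 with ∈-map⁻ (0 ∷_) b∈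
  isolated b∈ (zero ∷ u) (zero ∷ v) refl v≢0 | a , a∈ , refl
    with factor-unit v (n≢0⇒n>0 λ sum≡0 → v≢0 (cong (0 ∷_) (sum≡0⇒0v v sum≡0)))
  ... | i , w , refl = UniquelyFactored-factor g (0 ∷ u) (0 ∷ w)
                         (L-isolated a∈ i (u ⊕ w) (⊕-swap u (unit i) w))

  module _ (B : List (Vec ℕ (suc e))) (B⊆L : ∀ {x} → x ∈ B → x ∈ L⁺)
           (uncrossed : ∀ {r} → r ∈ R → ¬ Crosses B r) where

    -- An invariant of the congruence that forbids passing between `B` and its complement. Demanding
    -- that both sides have a second factorization makes it survive translation: a proper multiple
    -- of such a vector is never in `L⁺`, hence never in `B`.
    Linked : Vec ℕ (suc e) → Vec ℕ (suc e) → Set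
    Linked x y = x ≡ y ⊎
      (¬ UniquelyFactored g x × ¬ UniquelyFactored g y × (x ∈ B → y ∈ B) × (y ∈ B → x ∈ B))

    linked-sym : ∀ {x y} → Linked x y → Linked y x
    linked-sym (inj₁ eq)                   = inj₁ (sym eq)
    linked-sym (inj₂ (¬x , ¬y , x→y , y→x)) = inj₂ (¬y , ¬x , y→x , x→y)

    linked-trans : ∀ {x y z} → Linked x y → Linked y z → Linked x z
    linked-trans (inj₁ refl) l = l
    linked-trans l (inj₁ refl) = l
    linked-trans (inj₂ (¬x , _ , x→y , y→x)) (inj₂ (_ , ¬z , y→z , z→y)) =
      inj₂ (¬x , ¬z , y→z ∘ x→y , y→x ∘ z→y)

    ¬uniquelyFactored-⊕ : ∀ {x} z → ¬ UniquelyFactored g x → ¬ UniquelyFactored g (x ⊕ z)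
    ¬uniquelyFactored-⊕ {x} z ¬x uf = ¬x (UniquelyFactored-factor g x z uf)

    ⊕-∉ : ∀ {x} z → ¬ UniquelyFactored g x → z ≢ 0v → x ⊕ z ∉ B
    ⊕-∉ {x} z ¬x z≢0 xz∈B = ¬x (isolated (B⊆L xz∈B) x z refl z≢0)

    linked-⊕ : ∀ {x y} z → Linked x y → Linked (x ⊕ z) (y ⊕ z)
    linked-⊕ z (inj₁ refl) = inj₁ refl
    linked-⊕ {x} {y} z l@(inj₂ (¬x , ¬y , _)) with ≡-dec _≟_ z 0v
    ... | yes refl = subst₂ Linked (sym (⊕-identityʳ x)) (sym (⊕-identityʳ y)) l
    ... | no z≢0 = inj₂ (¬uniquelyFactored-⊕ z ¬x , ¬uniquelyFactored-⊕ z ¬y ,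
                         ⊥-elim ∘ ⊕-∉ z ¬x z≢0 , ⊥-elim ∘ ⊕-∉ z ¬y z≢0)

    genCong⇒linked : ∀ {x y} → GenCong R x y → Linked x y
    genCong⇒linked {x} {y} (base xy∈) with ≡-dec _≟_ x y
    ... | yes x≡y = inj₁ x≡y
    ... | no  x≢y = inj₂ ((λ uf → x≢y (sym (uf y (sym φ≡)))) , (λ uf → x≢y (uf x φ≡)) , x→y , y→x)
      where
      φ≡ : φ g x ≡ φ g y
      φ≡ = proj₂ (R-gen x y) (base xy∈)
      x→y : x ∈ B → y ∈ B
      x→y x∈ with y ∈? B
      ... | yes y∈ = y∈
      ... | no  y∉ = contradiction (inj₁ (x∈ , y∉)) (uncrossed xy∈)
      y→x : y ∈ B → x ∈ B
      y→x y∈ with x ∈? B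
      ... | yes x∈ = x∈
      ... | no  x∉ = contradiction (inj₂ (x∉ , y∈)) (uncrossed xy∈)
    genCong⇒linked refl′        = inj₁ refl
    genCong⇒linked (sym′ p)     = linked-sym (genCong⇒linked p)
    genCong⇒linked (trans′ p q) = linked-trans (genCong⇒linked p) (genCong⇒linked q)
    genCong⇒linked (plus {a} {b} {c} {d} p q) = linked-trans (linked-⊕ c (genCong⇒linked p))
      (subst₂ Linked (⊕-comm c b) (⊕-comm d b) (linked-⊕ b (genCong⇒linked q)))

    -- A member of `B` is congruent to its normal form. The two differ, so `Linked` would put the
    -- normal form into `B`, where every tail is reducible.
    uncrossed⇒empty : ∀ {b} → b ∉ B
    uncrossed⇒empty {b} b∈ with ∈-map⁻ (0 ∷_) (B⊆L b∈)
    ... | a , a∈ , refl with normalForm (0 ∷ a)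
    ...   | y , irr , a~y with genCong⇒linked (proj₁ (R-gen (0 ∷ a) y) (GenCong-sound g relations-sound a~y))
    ...     | inj₁ refl = irr (L-reducible a∈)
    ...     | inj₂ (_ , _ , a→y , _) with ∈-map⁻ (0 ∷_) (B⊆L (a→y b∈))
    ...       | c , c∈ , refl = irr (L-reducible c∈)

  lower-bound : length L ≤ length R
  lower-bound = subst (_≤ length R) (length-map (0 ∷_) L)
    (crossing-count (≡-dec _≟_) (length R) L⁺ R refl (Unique.map⁺ ∷-injective L!) λ B b∈ B⊆ → crossed B b∈ B⊆)
    where
    crossed : ∀ B {b} → b ∈ B → (∀ {x} → x ∈ B → x ∈ L⁺) → ∃[ r ] (r ∈ R × Crosses B r)
    crossed B b∈ B⊆ with any? (crosses? B) R
    ... | yes w  = find w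
    ... | no ¬w = contradiction b∈ (uncrossed⇒empty B B⊆ λ r∈ cr → ¬w (lose r∈ cr))

-- Monoids attaining the bound

euclid-unique : ∀ m .{{_ : NonZero m}} p q {x y} → x < m → y < m → p * m + x ≡ q * m + y → x ≡ y
euclid-unique m p q {x} {y} x<m y<m eq = begin
  x               ≡⟨ sym (m<n⇒m%n≡m x<m) ⟩
  x % m           ≡⟨ sym ([m+kn]%n≡m%n x p m) ⟩
  (x + p * m) % m ≡⟨ cong (_% m) (trans (+-comm x (p * m)) (trans eq (+-comm (q * m) y))) ⟩
  (y + q * m) % m ≡⟨ [m+kn]%n≡m%n y q m ⟩
  y % m           ≡⟨ m<n⇒m%n≡m y<m ⟩
  y               ∎
  where open ≡-Reasoning

-- Exponents as base 3 digits: in degree at most 2 every digit is at most 2, so distinct monomials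
-- get distinct numbers.
ternary : Vec ℕ n → ℕ
ternary []      = 0
ternary (x ∷ a) = x + 3 * ternary a

ternary-injective : (a b : Vec ℕ n) → sum a ≤ 2 → sum b ≤ 2 → ternary a ≡ ternary b → a ≡ b
ternary-injective []      []      _  _  _  = refl
ternary-injective (x ∷ a) (y ∷ b) a≤ b≤ eq = cong₂ _∷_ x≡y
  (ternary-injective a b (≤-trans (m≤n+m _ x) a≤) (≤-trans (m≤n+m _ y) b≤)
    (*-cancelˡ-≡ _ _ 3 (+-cancelˡ-≡ x _ _ (trans eq (cong (_+ 3 * ternary b) (sym x≡y))))))
  where
  swap : ∀ x t → t * 3 + x ≡ x + 3 * t
  swap = solve-∀
  x≡y : x ≡ y
  x≡y = euclid-unique 3 (ternary a) (ternary b)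
    (s≤s (≤-trans (m≤m+n x _) a≤)) (s≤s (≤-trans (m≤m+n y _) b≤))
    (trans (swap x (ternary a)) (trans eq (sym (swap y (ternary b)))))

ternary≤ : (a : Vec ℕ n) → ternary a ≤ sum a * 3 ^ n
ternary≤ []              = z≤n
ternary≤ {suc n} (x ∷ a) = begin
  x + 3 * ternary a                 ≤⟨ +-mono-≤ (≤-trans (≤-reflexive (sym (*-identityʳ x))) (*-monoʳ-≤ x (m^n>0 3 (suc n))))
                                                (*-monoʳ-≤ 3 (ternary≤ a)) ⟩
  x * 3 ^ suc n + 3 * (sum a * 3 ^ n) ≡⟨ lem x (sum a) (3 ^ n) ⟩
  (x + sum a) * 3 ^ suc n           ∎
  where
  open ≤-Reasoning
  lem : ∀ x s t → x * (3 * t) + 3 * (s * t) ≡ (x + s) * (3 * t)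
  lem = solve-∀

powers : ∀ n → ℕ → Vec ℕ n
powers zero    t = []
powers (suc n) t = t ∷ powers n (3 * t)

φ-powers : ∀ t (a : Vec ℕ n) → φ (powers n t) a ≡ t * ternary a
φ-powers t []      = sym (*-zeroʳ t)
φ-powers t (x ∷ a) = trans (cong (x * t +_) (φ-powers (3 * t) a)) (lem x t (ternary a))
  where
  lem : ∀ x t v → x * t + 3 * t * v ≡ t * (x + 3 * v)
  lem = solve-∀

φ-shift : ∀ s (g a : Vec ℕ n) → φ (mapᵛ (s +_) g) a ≡ sum a * s + φ g a
φ-shift s []      []      = refl
φ-shift s (w ∷ g) (x ∷ a) = trans (cong (x * (s + w) +_) (φ-shift s g a)) (lem x s w (sum a) (φ g a))
  where
  lem : ∀ x s w t f → x * (s + w) + (t * s + f) ≡ (x + t) * s + (x * w + f)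
  lem = solve-∀

φ-++ : (g : Vec ℕ k) {g′ : Vec ℕ l} (a : Vec ℕ k) {a′ : Vec ℕ l} → φ (g ++ᵛ g′) (a ++ᵛ a′) ≡ φ g a + φ g′ a′
φ-++ []      []      = refl
φ-++ (w ∷ g) (x ∷ a) = trans (cong (x * w +_) (φ-++ g a)) (sym (+-assoc (x * w) _ _))

0v-++ : ∀ k l → 0v {k} ++ᵛ 0v {l} ≡ 0v
0v-++ zero    l = refl
0v-++ (suc k) l = cong (0 ∷_) (0v-++ k l)

unit-split : ∀ k {l} (i : Fin (k + l)) → (∃[ j ] unit i ≡ unit {k} j ++ᵛ 0v) ⊎ (∃[ j ] unit i ≡ 0v {k} ++ᵛ unit j)
unit-split zero    i        = inj₂ (i , refl)
unit-split (suc k) fzero    = inj₁ (fzero , cong (1 ∷_) (sym (0v-++ k _)))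
unit-split (suc k) (fsuc i) with unit-split k i
... | inj₁ (j , eq) = inj₁ (fsuc j , cong (0 ∷_) eq)
... | inj₂ (j , eq) = inj₂ (j , cong (0 ∷_) eq)

sum-pad : (a : Vec ℕ k) → sum (a ++ᵛ 0v {l}) ≡ sum a
sum-pad {l = l} a = trans (sum-++ a) (trans (cong (sum a +_) (sum-0v l)) (+-identityʳ (sum a)))

⊕≡pad : ∀ k {l} (x u : Vec ℕ (k + l)) (w : Vec ℕ k) → x ⊕ u ≡ w ++ᵛ 0v →
        ∃[ x′ ] ∃[ u′ ] (x ≡ x′ ++ᵛ 0v × u ≡ u′ ++ᵛ 0v × x′ ⊕ u′ ≡ w)
⊕≡pad zero {l} x u [] eq = [] , [] ,
  sum≡0⇒0v x (m+n≡0⇒m≡0 (sum x) sum≡0) , sum≡0⇒0v u (m+n≡0⇒n≡0 (sum x) sum≡0) , refl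
  where
  sum≡0 : sum x + sum u ≡ 0
  sum≡0 = trans (sym (sum-⊕ x u)) (trans (cong sum eq) (sum-0v l))
⊕≡pad (suc k) (y ∷ x) (v ∷ u) (z ∷ w) eq with ⊕≡pad k x u w (cong tail eq)
... | x′ , u′ , refl , refl , refl = y ∷ x′ , v ∷ u′ , refl , refl , cong (_∷ x′ ⊕ u′) (cong head eq)

Increasing : Vec ℕ n → Set
Increasing = AllPairsV.AllPairs _<_

increasing-lookup : {v : Vec ℕ n} → Increasing v → ∀ i j → i <ᶠ j → lookup v i < lookup v j
increasing-lookup (v< AllPairsV.∷ vs) fzero    (fsuc j) _         = AllV.lookup⁺ v< j
increasing-lookup (v< AllPairsV.∷ vs) (fsuc i) (fsuc j) (s≤s i<j) = increasing-lookup vs i j i<j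

increasing-injective : {v : Vec ℕ n} → Increasing v → ∀ i j → lookup v i ≡ lookup v j → i ≡ j
increasing-injective inc i j eq with Fin.<-cmp i j
... | tri< i<j _ _ = contradiction (increasing-lookup inc i j i<j) (<-irrefl eq)
... | tri≈ _ i≡j _ = i≡j
... | tri> _ _ j<i = contradiction (increasing-lookup inc j i j<i) (<-irrefl (sym eq))

increasing-fromList : {xs : List ℕ} → AllPairs _<_ xs → Increasing (fromList xs)
increasing-fromList []         = AllPairsV.[]
increasing-fromList (x< ∷ xs<) = AllV.fromList⁺ x< AllPairsV.∷ increasing-fromList xs<

powers-≥ : ∀ n t → AllV.All (t ≤_) (powers n t)
powers-≥ zero    t = AllV.[]
powers-≥ (suc n) t = ≤-refl AllV.∷ AllV.map (≤-trans (m≤m+n t _)) (powers-≥ n (3 * t))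

powers-increasing : ∀ n t → 1 ≤ t → Increasing (powers n t)
powers-increasing zero    t t>0 = AllPairsV.[]
powers-increasing (suc n) t t>0 =
  AllV.map (≤-trans (m<m+n t (≤-trans t>0 (m≤m+n t _)))) (powers-≥ n (3 * t))
  AllPairsV.∷ powers-increasing n (3 * t) (≤-trans t>0 (m≤m+n t _))

powers-≤ : ∀ n t → AllV.All (_≤ t * 3 ^ n) (powers n t)
powers-≤ zero    t = AllV.[]
powers-≤ (suc n) t =
  ≤-trans (≤-reflexive (sym (*-identityʳ t))) (*-monoʳ-≤ t (m^n>0 3 (suc n)))
  AllV.∷ AllV.map (λ {x} p → subst (x ≤_) (lem t (3 ^ n)) p) (powers-≤ n (3 * t))
  where
  lem : ∀ t y → 3 * t * y ≡ t * (3 * y)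
  lem = solve-∀

unit-uniquelyFactored⇒minimal : (g : Vec ℕ n) → (∀ i → UniquelyFactored g (unit i)) →
  ∀ i → ¬ (∃[ a ] (lookup a i ≡ 0 × φ g a ≡ lookup g i))
unit-uniquelyFactored⇒minimal g uf i (a , aᵢ≡0 , eq) =
  lookup-unit i (trans (cong (λ x → lookup x i) (sym (uf i a (trans eq (sym (φ-unit g i)))))) aᵢ≡0)
  where
  lookup-unit : ∀ {n} (i : Fin n) → lookup (unit i) i ≢ 0
  lookup-unit (fsuc i) = lookup-unit i

-- Generators m, then 2m + 3^i for i ≤ b + c, then 3m + ρ for the residues ρ not yet represented
-- by the monomials of Std: those of degree at most 2 in the first b + c + 1 generators after m,
-- except that the first of these only multiplies the next b.
module Construction (b c m : ℕ) (large : 2 * 3 ^ suc (b + c) < m) where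

  h : ℕ
  h = suc (b + c)

  instance
    m≢0 : NonZero m
    m≢0 = >-nonZero (≤-trans (s≤s z≤n) large)

  m>0 : 0 < m
  m>0 = ≤-trans (s≤s z≤n) large

  withFirst : Vec ℕ b → Vec ℕ h
  withFirst p = 1 ∷ (p ++ᵛ 0v {c})

  withFirst-injective : ∀ {p q} → withFirst p ≡ withFirst q → p ≡ q
  withFirst-injective {p} {q} eq = ++-injectiveˡ p q (∷-injective eq)

  sum-withFirst : ∀ p → sum (withFirst p) ≡ suc (sum p)
  sum-withFirst p = cong suc (sum-pad {l = c} p)

  withFirst-disjoint : ∀ {as : List (Vec ℕ (b + c))} {ps a} → ¬ (a ∈ map (0 ∷_) as × a ∈ map withFirst ps)
  withFirst-disjoint (a∈₀ , a∈₁) with ∈-map⁻ (0 ∷_) a∈₀ | ∈-map⁻ withFirst a∈₁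
  ... | _ , _ , refl | _ , _ , ()

  Std : List (Vec ℕ h)
  Std = map (0 ∷_) (box (b + c) 2) ++ map withFirst (box b 1)

  Std-unique : Unique Std
  Std-unique = Unique.++⁺ (Unique.map⁺ ∷-injective (box-unique (b + c) 2))
    (Unique.map⁺ withFirst-injective (box-unique b 1)) withFirst-disjoint

  Std⇒sum≤2 : ∀ {w} → w ∈ Std → sum w ≤ 2
  Std⇒sum≤2 w∈ with ∈-++⁻ (map (0 ∷_) (box (b + c) 2)) w∈
  ... | inj₁ w∈₀ with ∈-map⁻ (0 ∷_) w∈₀
  ...   | v , v∈ , refl = ∈-box⁻ 2 v∈
  Std⇒sum≤2 w∈ | inj₂ w∈₁ with ∈-map⁻ withFirst w∈₁
  ... | p , p∈ , refl = subst (_≤ 2) (sym (sum-withFirst p)) (s≤s (∈-box⁻ 1 p∈))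

  ∈-Std-0∷ : ∀ v → sum v ≤ 2 → 0 ∷ v ∈ Std
  ∈-Std-0∷ v v≤2 = ∈-++⁺ˡ (∈-map⁺ (0 ∷_) (∈-box⁺ v 2 v≤2))

  ∈-Std-withFirst : ∀ p → sum p ≤ 1 → withFirst p ∈ Std
  ∈-Std-withFirst p p≤1 = ∈-++⁺ʳ (map (0 ∷_) (box (b + c) 2)) (∈-map⁺ withFirst (∈-box⁺ p 1 p≤1))

  sum≤1⇒Std : ∀ w → sum w ≤ 1 → w ∈ Std
  sum≤1⇒Std (zero ∷ v)        p       = ∈-Std-0∷ v (m≤n⇒m≤1+n p)
  sum≤1⇒Std (suc zero ∷ v)    (s≤s p) = subst (λ v → 1 ∷ v ∈ Std)
    (trans (0v-++ b c) (sym (sum≡0⇒0v v (n≤0⇒n≡0 p))))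
    (∈-Std-withFirst 0v (≤-trans (≤-reflexive (sum-0v b)) z≤n))
  sum≤1⇒Std (suc (suc x) ∷ v) (s≤s ())

  -- The summand `suc h` counts degrees 0 and 1; degree 2 contributes exactly `s`, block by block as
  -- in its Macaulay expansion with `A ≡ b + c`.
  length-Std : length Std ≡ suc h + (tri (b + c) + b)
  length-Std = begin
    length Std
      ≡⟨ trans (length-++ (map (0 ∷_) (box (b + c) 2)))
           (cong₂ _+_ (length-map (0 ∷_) (box (b + c) 2)) (length-map withFirst (box b 1))) ⟩
    length (box (b + c) 2) + length (box b 1)
      ≡⟨ cong₂ _+_ (trans (length-++ (mons (b + c) 2)) (cong₂ _+_ (length-mons-2 (b + c)) (length-box-1 (b + c))))
           (length-box-1 b) ⟩
    tri (b + c) + (b + c + 1) + (b + 1)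
      ≡⟨ lem (tri (b + c)) (b + c) b ⟩
    suc h + (tri (b + c) + b) ∎
    where
    open ≡-Reasoning
    length-box-1 : ∀ n → length (box n 1) ≡ n + 1
    length-box-1 n = trans (length-++ (mons n 1)) (cong₂ _+_ (length-mons-1 n) (length-mons-0 n))
    lem : ∀ t n b → t + (n + 1) + (b + 1) ≡ suc (suc n) + (t + b)
    lem = solve-∀

  ternary<m : (a : Vec ℕ h) → sum a ≤ 2 → ternary a < m
  ternary<m a a≤2 = ≤-<-trans (≤-trans (ternary≤ a) (*-monoˡ-≤ (3 ^ h) a≤2)) large

  ternary-0v : ternary (0v {h}) ≡ 0
  ternary-0v = n≤0⇒n≡0 (≤-trans (ternary≤ (0v {h})) (≤-reflexive (cong (_* 3 ^ h) (sum-0v h))))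

  used : List ℕ
  used = map ternary Std

  used-unique : Unique used
  used-unique = unique-map ternary
    (λ {x} {y} x∈ y∈ → ternary-injective x y (Std⇒sum≤2 x∈) (Std⇒sum≤2 y∈)) Std-unique

  used<m : ∀ {x} → x ∈ used → x < m
  used<m x∈ with ∈-map⁻ ternary x∈
  ... | w , w∈ , refl = ternary<m w (Std⇒sum≤2 w∈)

  open DecMembership _≟_ using (_∈?_)

  used? : Decidable (_∈ used)
  used? x = x ∈? used

  free : List ℕ
  free = filter (∁? used?) (upTo m)

  #free : ℕ
  #free = length free

  length-free : suc h + (tri (b + c) + b) + #free ≡ m
  length-free = begin
    suc h + (tri (b + c) + b) + #free             ≡⟨ cong (_+ #free) (sym (trans (length-map ternary Std) length-Std)) ⟩
    length used + #free                           ≡⟨ cong (_+ #free) (≤-antisym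
        (unique-length-≤ used-unique (λ x∈ → ∈-filter⁺ used? (∈-upTo⁺ (used<m x∈)) x∈))
        (unique-length-≤ (Unique.filter⁺ used? (Unique.upTo⁺ m)) (λ x∈ → proj₂ (∈-filter⁻ used? {xs = upTo m} x∈)))) ⟩
    length (filter used? (upTo m)) + #free        ≡⟨ length-split used? (upTo m) ⟩
    length (upTo m)                           ≡⟨ length-upTo m ⟩
    m                                         ∎
    where open ≡-Reasoning

  ρ : Vec ℕ #free
  ρ = fromList free

  ρ-increasing : Increasing ρ
  ρ-increasing = increasing-fromList (AllPairs.filter⁺ (∁? used?) (AllPairs.applyUpTo⁺₁ id m (λ i<j _ → i<j)))

  ρ-free : ∀ j → lookup ρ j < m × lookup ρ j ∉ used
  ρ-free = AllV.lookup⁺ (AllV.fromList⁺ (All.tabulate λ x∈ →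
    let x∈upTo , x∉ = ∈-filter⁻ (∁? used?) {xs = upTo m} x∈ in ∈-upTo⁻ x∈upTo , x∉))

  -- With levels 1, 2 and 3 for `m`, `small` and `big`, a product of two small generators has level
  -- 4: below any product of a big generator with another small or big one, and above a single big
  -- one. A quadratic monomial in the small generators outside `Std` can thus equal `m` plus a big
  -- generator, while big generators keep a single factorization.
  small : Vec ℕ h
  small = mapᵛ (2 * m +_) (powers h 1)

  big : Vec ℕ #free
  big = mapᵛ (3 * m +_) ρ

  γ : Vec ℕ (h + #free)
  γ = small ++ᵛ big

  g : Vec ℕ (suc (h + #free))
  g = m ∷ γ

  g-increasing : Increasing g
  g-increasing =
    AllV.++⁺ (AllV.map⁺ (AllV.universal (λ x → ≤-trans (m<m+n m (≤-trans m>0 (m≤m+n m 0))) (m≤m+n (2 * m) x)) (powers h 1)))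
             (AllV.map⁺ (AllV.universal (λ x → ≤-trans (m<m+n m (≤-trans m>0 (m≤m+n m (m + 0)))) (m≤m+n (3 * m) x)) ρ))
    AllPairsV.∷ AllPairsV.++⁺
      (AllPairsV.map⁺ (AllPairsV.map (+-monoʳ-< (2 * m)) (powers-increasing h 1 (s≤s z≤n))))
      (AllPairsV.map⁺ (AllPairsV.map (+-monoʳ-< (3 * m)) ρ-increasing))
      (AllV.map⁺ (AllV.map (λ {x} x≤ → AllV.map⁺ (AllV.universal (λ y →
        <-≤-trans (subst (2 * m + x <_) (lem m) (+-monoʳ-< (2 * m) (≤-<-trans x≤ pow<m))) (m≤m+n (3 * m) y)) ρ))
        (powers-≤ h 1)))
    where
    lem : ∀ m → 2 * m + m ≡ 3 * m
    lem = solve-∀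
    pow<m : 1 * 3 ^ h < m
    pow<m = ≤-<-trans (*-monoˡ-≤ (3 ^ h) (s≤s (z≤n {1}))) large

  mono : ℕ → Vec ℕ h → Vec ℕ #free → Vec ℕ (suc (h + #free))
  mono k u v = k ∷ (u ++ᵛ v)

  -- The rest of the value, `ternary u + φ ρ v`, may exceed `m`, so this bounds the quotient by `m`
  -- only from below.
  level : ℕ → Vec ℕ h → Vec ℕ #free → ℕ
  level k u v = k + 2 * sum u + 3 * sum v

  φ-level : ∀ k u v → φ g (mono k u v) ≡ level k u v * m + (ternary u + φ ρ v)
  φ-level k u v = begin
    k * m + φ γ (u ++ᵛ v)
      ≡⟨ cong (k * m +_) (trans (φ-++ small u) (cong₂ _+_
           (trans (φ-shift (2 * m) (powers h 1) u) (cong (sum u * (2 * m) +_) (φ-powers 1 u)))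
           (φ-shift (3 * m) ρ v))) ⟩
    k * m + (sum u * (2 * m) + 1 * ternary u + (sum v * (3 * m) + φ ρ v))
      ≡⟨ lem k m (sum u) (ternary u) (sum v) (φ ρ v) ⟩
    level k u v * m + (ternary u + φ ρ v) ∎
    where
    open ≡-Reasoning
    lem : ∀ k m su tu sv fv →
      k * m + (su * (2 * m) + 1 * tu + (sv * (3 * m) + fv)) ≡ (k + 2 * su + 3 * sv) * m + (tu + fv)
    lem = solve-∀

  φ-level-pad : ∀ k u → φ g (mono k u 0v) ≡ (k + 2 * sum u) * m + ternary u
  φ-level-pad k u = trans (φ-level k u 0v)
    (cong₂ _+_ (cong (_* m) (trans (cong (λ s → k + 2 * sum u + 3 * s) (sum-0v #free)) (+-identityʳ _)))
               (trans (cong (ternary u +_) (φ-0v ρ)) (+-identityʳ _)))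

  φ-level-unit : ∀ k u j → φ g (mono k u (unit j)) ≡ (k + 2 * sum u + 3) * m + (ternary u + lookup ρ j)
  φ-level-unit k u j = trans (φ-level k u (unit j))
    (cong₂ _+_ (cong (λ s → (k + 2 * sum u + 3 * s) * m) (sum-unit j)) (cong (ternary u +_) (φ-unit ρ j)))

  φ-big : ∀ k j → φ g (mono k 0v (unit j)) ≡ (k + 3) * m + lookup ρ j
  φ-big k j = trans (φ-level-unit k 0v j)
    (cong₂ _+_ (cong (λ s → (s + 3) * m) (trans (cong (λ s → k + 2 * s) (sum-0v h)) (+-identityʳ k)))
               (cong (_+ lookup ρ j) ternary-0v))

  level-≤ : ∀ k u v {q r} → r < m → φ g (mono k u v) ≡ q * m + r → level k u v ≤ q
  level-≤ k u v {q} {r} r<m eq = ≤-pred (*-cancelʳ-< m _ (suc q) (begin-strict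
    level k u v * m                        ≤⟨ m≤m+n _ (ternary u + φ ρ v) ⟩
    level k u v * m + (ternary u + φ ρ v)  ≡⟨ trans (sym (φ-level k u v)) eq ⟩
    q * m + r                              <⟨ +-monoʳ-< (q * m) r<m ⟩
    q * m + m                              ≡⟨ +-comm (q * m) m ⟩
    suc q * m                              ∎))
    where open ≤-Reasoning

  -- The shapes of level at most 4: the sums 2 + 3, 3 + 3 and 2 + 2 + 2 all exceed it.
  data ShortView : ℕ → Vec ℕ h → Vec ℕ #free → Set where
    noBig  : ∀ {k u} → sum u ≤ 2 → ShortView k u 0v
    oneBig : ∀ {k} j → k ≤ 1 → ShortView k 0v (unit j)

  shortView : ∀ k u v → level k u v ≤ 4 → ShortView k u v
  shortView k u v lv≤4 with sum v in sv
  ... | zero rewrite sum≡0⇒0v v sv = noBig (*-cancelˡ-≤ 2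
          (≤-trans (m≤n+m _ k) (≤-trans (m≤m+n _ 0) lv≤4)))
  ... | suc (suc n) = contradiction
          (≤-trans (*-monoʳ-≤ 3 (s≤s (s≤s (z≤n {n})))) (≤-trans (m≤n+m _ (k + 2 * sum u)) lv≤4)) λ { (s≤s (s≤s (s≤s (s≤s ())))) }
  ... | suc zero with sum≡1⇒unit v sv
  ...   | j , refl with sum u in su
  ...     | zero rewrite sum≡0⇒0v u su = oneBig j
              (≤-trans (m≤m+n k 0) (+-cancelʳ-≤ 3 (k + 0) 1 lv≤4))
  ...     | suc n = contradiction
              (≤-trans (+-monoˡ-≤ 3 (≤-trans (*-monoʳ-≤ 2 (s≤s (z≤n {n}))) (m≤n+m _ k))) lv≤4)
              λ { (s≤s (s≤s (s≤s (s≤s ())))) }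

  -- Residues modulo `m` decide: without a big generator the ternary codes agree, and with one the
  -- residue is free, hence not that of a member of `Std`.
  Std-unique-view : ∀ {w} → w ∈ Std → ∀ {k u v} → ShortView k u v →
    φ g (mono k u v) ≡ φ g (mono 0 w 0v) → mono k u v ≡ mono 0 w 0v
  Std-unique-view {w} w∈ {k} {u} (noBig u≤2) eq = main (ternary-injective u w u≤2 w≤2
      (euclid-unique m (k + 2 * sum u) (2 * sum w) (ternary<m u u≤2) (ternary<m w w≤2) eq′))
    where
    w≤2 = Std⇒sum≤2 w∈
    eq′ : (k + 2 * sum u) * m + ternary u ≡ 2 * sum w * m + ternary w
    eq′ = trans (sym (φ-level-pad k u)) (trans eq (φ-level-pad 0 w))
    main : u ≡ w → mono k u 0v ≡ mono 0 w 0v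
    main refl = cong (λ k → mono k u 0v) (+-cancelʳ-≡ (2 * sum u) k 0 (*-cancelʳ-≡ _ _ m (+-cancelʳ-≡ (ternary u) _ _ eq′)))
  Std-unique-view {w} w∈ {k} (oneBig j _) eq = contradiction (∈-map⁺ ternary w∈)
      (subst (_∉ used) ρ≡ (proj₂ (ρ-free j)))
    where
    ρ≡ : lookup ρ j ≡ ternary w
    ρ≡ = euclid-unique m (k + 3) (2 * sum w) (proj₁ (ρ-free j)) (ternary<m w (Std⇒sum≤2 w∈))
      (trans (sym (φ-big k j)) (trans eq (φ-level-pad 0 w)))

  Std-uniquelyFactored : ∀ {w} → w ∈ Std → UniquelyFactored g (mono 0 w 0v)
  Std-uniquelyFactored {w} w∈ (k ∷ x) eq with splitAt h x
  ... | u , v , refl = Std-unique-view w∈ (shortView k u v (≤-trans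
      (level-≤ k u v {q = 2 * sum w} (ternary<m w (Std⇒sum≤2 w∈)) (trans eq (φ-level-pad 0 w)))
      (*-monoʳ-≤ 2 (Std⇒sum≤2 w∈)))) eq

  big-unique-view : ∀ j {k u v} → ShortView k u v → level k u v ≤ 3 →
    φ g (mono k u v) ≡ φ g (mono 0 0v (unit j)) → mono k u v ≡ mono 0 0v (unit j)
  -- Level at most 3 leaves at most one small generator, and its residue lies in `used`.
  big-unique-view j {k} {u} (noBig u≤2) lv≤3 eq = contradiction
      (∈-map⁺ ternary (sum≤1⇒Std u (≤-pred (*-cancelˡ-< 2 (sum u) 2 (s≤s 2u≤3)))))
      (subst (_∉ used) ρ≡ (proj₂ (ρ-free j)))
    where
    2u≤3 : 2 * sum u ≤ 3
    2u≤3 = ≤-trans (m≤n+m _ k) (≤-trans (m≤m+n _ (3 * sum (0v {#free}))) lv≤3)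
    ρ≡ : lookup ρ j ≡ ternary u
    ρ≡ = euclid-unique m 3 (k + 2 * sum u) (proj₁ (ρ-free j)) (ternary<m u u≤2)
           (trans (sym (φ-big 0 j)) (trans (sym eq) (φ-level-pad k u)))
  big-unique-view j {k} (oneBig j′ _) lv≤3 eq = cong₂ (λ k j → mono k 0v (unit j))
      (+-cancelʳ-≡ 3 k 0 (*-cancelʳ-≡ (k + 3) 3 m (+-cancelʳ-≡ (lookup ρ j) _ _
        (trans (cong ((k + 3) * m +_) (sym ρ≡)) eq′))))
      (increasing-injective ρ-increasing j′ j ρ≡)
    where
    eq′ : (k + 3) * m + lookup ρ j′ ≡ 3 * m + lookup ρ j
    eq′ = trans (sym (φ-big k j′)) (trans eq (φ-big 0 j))
    ρ≡ : lookup ρ j′ ≡ lookup ρ j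
    ρ≡ = euclid-unique m (k + 3) 3 (proj₁ (ρ-free j′)) (proj₁ (ρ-free j)) eq′

  big-uniquelyFactored : ∀ j → UniquelyFactored g (mono 0 0v (unit j))
  big-uniquelyFactored j (k ∷ x) eq with splitAt h x
  ... | u , v , refl = big-unique-view j (shortView k u v (m≤n⇒m≤1+n lv≤3)) lv≤3 eq
    where
    lv≤3 : level k u v ≤ 3
    lv≤3 = level-≤ k u v {q = 3} (proj₁ (ρ-free j)) (trans eq (φ-big 0 j))

  m-uniquelyFactored : UniquelyFactored g (unit fzero)
  m-uniquelyFactored (k ∷ x) eq with splitAt h x
  ... | u , v , refl with level-≤ k u v {q = 1} m>0 (trans eq φ-m)
    where
    φ-m : φ g (unit fzero) ≡ 1 * m + 0
    φ-m = trans (φ-unit g fzero) (sym (trans (+-identityʳ _) (+-identityʳ m)))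
  ...   | lv≤1 with sum u in su | sum v in sv
  ...     | suc n | _ = contradiction (≤-trans (*-monoʳ-≤ 2 (s≤s (z≤n {n}))) (≤-trans (m≤n+m _ k) (≤-trans (m≤m+n _ _) lv≤1)))
                          λ { (s≤s ()) }
  ...     | zero | suc n = contradiction (≤-trans (*-monoʳ-≤ 3 (s≤s (z≤n {n}))) (≤-trans (m≤n+m _ (k + 0)) lv≤1))
                          λ { (s≤s ()) }
  ...     | zero | zero = cong₂ _∷_ k≡1 x≡0
    where
    x≡0 : u ++ᵛ v ≡ 0v
    x≡0 = trans (cong₂ _++ᵛ_ (sum≡0⇒0v u su) (sum≡0⇒0v v sv)) (0v-++ h #free)
    k≡1 : k ≡ 1
    k≡1 = *-cancelʳ-≡ k 1 m (+-cancelʳ-≡ (φ γ (u ++ᵛ v)) (k * m) (1 * m)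
      (trans eq (cong (λ y → 1 * m + φ γ y) (sym x≡0))))

  unit-uniquelyFactored′ : ∀ i → UniquelyFactored g (unit i)
  unit-uniquelyFactored′ fzero    = m-uniquelyFactored
  unit-uniquelyFactored′ (fsuc i) with unit-split h i
  ... | inj₁ (j , eq) = subst (λ y → UniquelyFactored g (0 ∷ y)) (sym eq)
                          (Std-uniquelyFactored (sum≤1⇒Std (unit j) (≤-reflexive (sum-unit j))))
  ... | inj₂ (j , eq) = subst (λ y → UniquelyFactored g (0 ∷ y)) (sym eq) (big-uniquelyFactored j)

  cofinite : ∀ n → 2 * m * m ≤ n → InMonoid g n
  -- The generator `2 * m + 1`, taken `r` times, supplies the residue at a cost of `2 * r` multiples
  -- of `m`; the threshold `2 * m * m` makes the quotient large enough to pay.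
  cofinite n large-n = (n / m ∸ 2 * r) ∷ r ∷ 0v , (begin
    (n / m ∸ 2 * r) * m + (r * (2 * m + 1) + φ _ (0v {b + c + #free}))
      ≡⟨ cong (λ z → (n / m ∸ 2 * r) * m + (r * (2 * m + 1) + z)) (φ-0v (tail γ)) ⟩
    (n / m ∸ 2 * r) * m + (r * (2 * m + 1) + 0)
      ≡⟨ lem (n / m ∸ 2 * r) r m ⟩
    r + (n / m ∸ 2 * r + 2 * r) * m
      ≡⟨ cong (λ q → r + q * m) (m∸n+n≡m 2r≤q) ⟩
    r + n / m * m
      ≡⟨ sym (m≡m%n+[m/n]*n n m) ⟩
    n ∎)
    where
    open ≡-Reasoning
    r = n % m
    2r≤q : 2 * r ≤ n / m
    2r≤q = ≤-trans (*-monoʳ-≤ 2 (<⇒≤ (m%n<n n m)))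
             (subst (_≤ n / m) (m*n/n≡m (2 * m) m) (/-monoˡ-≤ m large-n))
    lem : ∀ q r m → q * m + (r * (2 * m + 1) + 0) ≡ r + (q + 2 * r) * m
    lem = solve-∀

  minGens : IsMinGens (h + #free) g
  minGens = increasing-lookup g-increasing ,
    unit-uniquelyFactored⇒minimal g unit-uniquelyFactored′ ,
    2 * m * m , cofinite

  -- Relations forced in the constructed monoid

  open Apéry m γ minGens using (Reducible; reducible?; irreducible-count)

  cubics : List (Vec ℕ h)
  cubics = map (0 ∷_) (mons (b + c) 3) ++ map withFirst (mons b 2)

  cubics-unique : Unique cubics
  cubics-unique = Unique.++⁺ (Unique.map⁺ ∷-injective (mons-unique (b + c) 3))
    (Unique.map⁺ withFirst-injective (mons-unique b 2)) withFirst-disjoint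

  -- Macaulay's bound is attained: cubics in `b + c` variables, and the first variable times
  -- quadratics in `b` variables, give the two binomials of s^⟨2⟩.
  length-cubics : length cubics ≡ F (tri (b + c) + b)
  length-cubics = begin
    length cubics
      ≡⟨ trans (length-++ (map (0 ∷_) (mons (b + c) 3)))
           (cong₂ _+_ (length-map (0 ∷_) (mons (b + c) 3)) (length-map withFirst (mons b 2))) ⟩
    length (mons (b + c) 3) + length (mons b 2)
      ≡⟨ cong₂ _+_ (length-mons-3 (b + c)) (length-mons-2 b) ⟩
    tet (b + c) + tri b
      ≡⟨ sym (F-block (b + c) b (m≤n⇒m≤1+n (m≤m+n b c))) ⟩
    F (tri (b + c) + b) ∎
    where open ≡-Reasoning

  cubic-sum : ∀ {w} → w ∈ cubics → sum w ≡ 3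
  cubic-sum w∈ with ∈-++⁻ (map (0 ∷_) (mons (b + c) 3)) w∈
  ... | inj₁ w∈₀ with ∈-map⁻ (0 ∷_) w∈₀
  ...   | v , v∈ , refl = ∈-mons⁻ (b + c) 3 v∈
  cubic-sum w∈ | inj₂ w∈₁ with ∈-map⁻ withFirst w∈₁
  ... | p , p∈ , refl = trans (sum-withFirst p) (cong suc (∈-mons⁻ b 2 p∈))

  cubic-factor : ∀ x u → x ⊕ u ∈ cubics → sum u ≤ 2 → u ∈ Std
  cubic-factor (x₀ ∷ x) (zero ∷ u) _ u≤2 = ∈-Std-0∷ u u≤2
  cubic-factor (x₀ ∷ x) (suc u₀ ∷ u) w∈ u≤2 with ∈-++⁻ (map (0 ∷_) (mons (b + c) 3)) w∈
  ... | inj₁ w∈₀ with ∈-map⁻ (0 ∷_) w∈₀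
  ...   | v , v∈ , eq = contradiction (trans (sym (+-suc x₀ u₀)) (cong head eq)) λ ()
  cubic-factor (x₀ ∷ x) (suc u₀ ∷ u) w∈ u≤2 | inj₂ w∈₁ with ∈-map⁻ withFirst w∈₁
  ... | p , p∈ , eq with ⊕≡pad b x u p (cong tail eq)
  ...   | x′ , u′ , refl , refl , refl
    with m+n≡0⇒n≡0 x₀ (suc-injective (trans (sym (+-suc x₀ u₀)) (cong head eq)))
  ...     | refl = ∈-Std-withFirst u′ (≤-pred (subst (_≤ 2) (sum-withFirst u′) u≤2))

  pad : Vec ℕ h → Vec ℕ (h + #free)
  pad w = w ++ᵛ 0v

  candidates : List (Vec ℕ (h + #free))
  candidates = mons (h + #free) 2 ++ map pad cubics

  candidates-unique : Unique candidates
  candidates-unique = Unique.++⁺ (mons-unique (h + #free) 2)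
    (Unique.map⁺ (λ {u} {w} → ++-injectiveˡ u w) cubics-unique)
    λ (a∈₂ , a∈₃) → contradiction (trans (sym (∈-mons⁻ (h + #free) 2 a∈₂)) (padded a∈₃)) λ ()
    where
    padded : ∀ {a} → a ∈ map pad cubics → sum a ≡ 3
    padded a∈ with ∈-map⁻ pad a∈
    ... | w , w∈ , refl = trans (sum-pad {l = #free} w) (cubic-sum w∈)

  candidate-2≤sum : ∀ {a} → a ∈ candidates → 2 ≤ sum a
  candidate-2≤sum a∈ with ∈-++⁻ (mons (h + #free) 2) a∈
  ... | inj₁ a∈₂ = ≤-reflexive (sym (∈-mons⁻ (h + #free) 2 a∈₂))
  ... | inj₂ a∈₃ with ∈-map⁻ pad a∈₃
  ...   | w , w∈ , refl = subst (2 ≤_) (sym (trans (sum-pad {l = #free} w) (cubic-sum w∈))) (s≤s (s≤s z≤n))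

  candidate-isolated : ∀ {a} → a ∈ candidates → ∀ i u → a ≡ unit i ⊕ u → UniquelyFactored g (0 ∷ u)
  candidate-isolated a∈ i u refl with ∈-++⁻ (mons (h + #free) 2) a∈
  ... | inj₁ a∈₂ with sum≡1⇒unit u (suc-injective (trans (sym (sum-unit-⊕ i u)) (∈-mons⁻ (h + #free) 2 a∈₂)))
  ...   | j , refl = unit-uniquelyFactored′ (fsuc j)
  candidate-isolated a∈ i u refl | inj₂ a∈₃ with ∈-map⁻ pad a∈₃
  ... | w , w∈ , eq with ⊕≡pad h (unit i) u w eq
  ...   | x , u′ , _ , refl , refl = Std-uniquelyFactored (cubic-factor x u′ w∈
            (≤-reflexive (trans (sym (sum-pad {l = #free} u′)) (suc-injective (trans (sym (sum-unit-⊕ i u))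
              (trans (cong sum eq) (trans (sum-pad {l = #free} (x ⊕ u′)) (cubic-sum w∈))))))))

  isolated : List (Vec ℕ (h + #free))
  isolated = filter reducible? candidates

  -- Counting residues leaves room for at most `s` irreducible candidates, so all others are
  -- reducible without a single reduction being exhibited.
  length-isolated : tri (h + #free) + F (tri (b + c) + b) ≤ length isolated + (tri (b + c) + b)
  length-isolated = begin
    tri (h + #free) + F (tri (b + c) + b)
      ≡⟨ sym (trans (length-++ (mons (h + #free) 2))
                    (cong₂ _+_ (length-mons-2 (h + #free)) (trans (length-map pad cubics) length-cubics))) ⟩
    length candidates
      ≡⟨ sym (length-split reducible? candidates) ⟩
    length isolated + length rest
      ≤⟨ +-monoʳ-≤ (length isolated) (+-cancelˡ-≤ (suc (h + #free)) _ _
           (subst (suc (h + #free) + length rest ≤_) (trans (sym length-free) (lem h #free (tri (b + c) + b)))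
             (irreducible-count (Unique.filter⁺ (∁? reducible?) candidates-unique)
               λ a∈ → let a∈′ , irr = ∈-filter⁻ (∁? reducible?) {xs = candidates} a∈
                      in candidate-2≤sum a∈′ , irr))) ⟩
    length isolated + (tri (b + c) + b) ∎
    where
    open ≤-Reasoning
    rest = filter (∁? reducible?) candidates
    lem : ∀ h f s → suc h + s + f ≡ suc (h + f) + s
    lem = solve-∀

  relations-count : ∀ R → Generates g R → tri (h + #free) + F (tri (b + c) + b) ≤ length R + (tri (b + c) + b)
  relations-count R R-gen = ≤-trans length-isolated (+-monoˡ-≤ (tri (b + c) + b)
    (LowerBound.lower-bound m γ minGens isolated
      (Unique.filter⁺ reducible? candidates-unique)
      (λ a∈ → proj₂ (∈-filter⁻ reducible? {xs = candidates} a∈))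
      (λ a∈ → candidate-isolated (proj₁ (∈-filter⁻ reducible? {xs = candidates} a∈)))
      R R-gen))

  witness : ∀ e → suc e + (tri (b + c) + b) ≡ m →
    ∃[ γ ] (IsMinGens e (m ∷ γ) ×
      (∀ R → Generates (m ∷ γ) R → tri e + F (tri (b + c) + b) ≤ length R + (tri (b + c) + b)))
  witness e m≡ with h+free≡e
    where
    lem : ∀ h f s → suc h + s + f ≡ suc (h + f) + s
    lem = solve-∀
    h+free≡e : h + #free ≡ e
    h+free≡e = suc-injective (+-cancelʳ-≡ (tri (b + c) + b) _ _
      (trans (sym (lem h #free (tri (b + c) + b))) (trans length-free (sym m≡))))
  ... | refl = γ , minGens , relations-count

-- The maximum and its Macaulay value

isMaxRho : ∀ e m s → suc e + s ≡ m →
  ∃[ γ ] (IsMinGens e (m ∷ γ) × (∀ R → Generates (m ∷ γ) R → tri e + F s ≤ length R + s)) →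
  IsMaxRho e m (tri e + F s ∸ s)
isMaxRho e m s m≡ (γ , G , lower) =
  (m ∷ γ , G , refl ,
    (relations , ≤-antisym upper (lower′ relations relations-generate) , relations-generate) , lower′) ,
  λ { (_ ∷ γ′) n G′ refl (_ , minimal) →
      ≤-trans (minimal (Apéry.relations m γ′ G′) (Apéry.relations-generate m γ′ G′))
              (m+n≤o⇒m≤o∸n _ (Apéry.length-relations m γ′ G′ s m≡)) }
  where
  open Apéry m γ G using (relations; relations-generate; length-relations)
  upper : length relations ≤ tri e + F s ∸ s
  upper = m+n≤o⇒m≤o∸n _ (length-relations s m≡)
  lower′ : ∀ R → Generates (m ∷ γ) R → tri e + F s ∸ s ≤ length R
  lower′ R R-gen = m≤n+o⇒m∸n≤o _ s (subst (tri e + F s ≤_) (+-comm (length R) s) (lower R R-gen))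

Cval-1 : ∀ e m s → suc e + s ≡ m → Cval e m 1 ≡ tri e + F s ∸ s
Cval-1 e m s refl
  rewrite +-comm e 1 | nC1≡n (suc e) | m+n∸m≡n (suc e) s | tri≡C e | F-unfold s = refl

-- Pascal's rule. It reduces the exclusion of every `r'` above 1 to comparing `m` with
-- `(e + 2) C 2`.
C-diagonal-mono : ∀ e r k → (e + r) C r ≤ (e + (k + r)) C (k + r)
C-diagonal-mono e r zero    = ≤-refl
C-diagonal-mono e r (suc k) = ≤-trans (C-diagonal-mono e r k)
  (subst (λ n → (e + (k + r)) C (k + r) ≤ n C suc (k + r)) (sym (+-suc e (k + r)))
    (subst ((e + (k + r)) C (k + r) ≤_) (nCk+nC[k+1]≡[n+1]C[k+1] (e + (k + r)) (k + r)) (m≤m+n _ _)))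

theorem3p2 : ∀ (δ : ℕ) → 1 ≤ δ → ∃[ M ] (∀ (e m : ℕ) → 3 ≤ e → e < m → m ≡ e + δ → M ≤ m →
    ∀ (r' : ℕ) → ((e + r') C r') ≤ m → m < ((e + suc r') C suc r') →
    IsMaxRho e m (Cval e m r'))
theorem3p2 (suc s) _ with block s
... | A , b , b≤A , refl with m≤n⇒∃[o]m+o≡n b≤A
-- The part `δ + δ` forces `δ ≤ e`, so `m ≤ e + e < (e + 2) C 2` and only `r' ≡ 1` remains; the
-- other summand is the hypothesis `large` of `Construction`.
...   | c , refl = δ + δ + suc (2 * 3 ^ suc (b + c)) , proof
  where
  δ = suc (tri (b + c) + b)
  proof : ∀ (e m : ℕ) → 3 ≤ e → e < m → m ≡ e + δ → δ + δ + suc (2 * 3 ^ suc (b + c)) ≤ m →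
    ∀ r → ((e + r) C r) ≤ m → m < ((e + suc r) C suc r) → IsMaxRho e m (Cval e m r)
  proof e m _ e<m _ _ zero _ m<C = contradiction
    (subst (m <_) (trans (cong (_C 1) (+-comm e 1)) (nC1≡n (suc e))) m<C) (≤⇒≯ e<m)
  proof e m _ _ m≡ M≤m 1 _ _ = subst (IsMaxRho e m) (sym (Cval-1 e m (tri (b + c) + b) m≡′))
    (isMaxRho e m (tri (b + c) + b) m≡′
      (Construction.witness b c m (≤-trans (m≤n+m _ (δ + δ)) M≤m) e m≡′))
    where
    m≡′ : suc e + (tri (b + c) + b) ≡ m
    m≡′ = trans (sym (+-suc e _)) (sym m≡)
  proof e m _ _ m≡ M≤m (suc (suc k)) C≤m _ = contradiction (begin-strict
    m                            ≡⟨ m≡ ⟩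
    e + δ                        ≤⟨ +-monoʳ-≤ e δ≤e ⟩
    e + e                        <⟨ s≤s (+-monoʳ-≤ e (n≤tri e)) ⟩
    tri (suc e)                  ≡⟨ trans (sym (tri≡C (suc e))) (cong (_C 2) (+-comm 2 e)) ⟩
    (e + 2) C 2                  ≤⟨ C-diagonal-mono e 2 k ⟩
    (e + (k + 2)) C (k + 2)      ≡⟨ cong (λ r → (e + r) C r) (+-comm k 2) ⟩
    (e + suc (suc k)) C suc (suc k) ∎) (≤⇒≯ C≤m)
    where
    open ≤-Reasoning
    δ≤e : δ ≤ e
    δ≤e = +-cancelʳ-≤ δ δ e (≤-trans (m≤m+n _ _) (subst (δ + δ + suc (2 * 3 ^ suc (b + c)) ≤_) m≡ M≤m))
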